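{- If $n\geq 5$ is an integer, then the generalized Petersen graph $P(n,2)$ is irreducible.
   Context: Graphs are finite, simple and undirected; $d_G(x,y)$ is the distance between $x$ and $y$ in $G$. A vertex $w$ resolves a pair of vertices $u,v$ if $d_G(u,w)\neq d_G(v,w)$. A set $W\subseteq V(G)$ is a resolving set for $G$ if every pair of distinct vertices of $G$ is resolved by some vertex of $W$. The metric dimension $\beta(G)$ is the minimum cardinality of a resolving set for $G$ (with $\beta(K_1)=0$). The threshold dimension is $\tau(G)=\min\{\beta(H): H \text{ contains } G \text{ as a spanning subgraph}\}$, i.e. the minimum metric dimension among all graphs $H$ with $V(H)=V(G)$ and $E(G)\subseteq E(H)$. A graph $G$ is irreducible if $\tau(G)=\beta(G)$. The generalized Petersen graph $P(n,k)$ is the graph with vertex set $\{u_1,\dots,u_n,v_1,\dots,v_n\}$ and edge set $\{v_iv_{i+1},\ u_iv_i,\ u_iu_{i+k} : 1\leq i\leq n\}$, with indices taken modulo $n$. -}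

module Defs where

open import Data.Fin using (Fin; toℕ; splitAt)
open import Data.Fin.Properties using (nonZeroIndex; toℕ<n; toℕ-fromℕ<; _≟_)
open import Data.Fin.Subset using (Subset; _∈_; ∣_∣)
open import Data.Nat using (ℕ; zero; suc; _+_; _∸_; _%_; _≤_; _<_; NonZero; s≤s; ≢-nonZero⁻¹; >-nonZero⁻¹)
open import Data.Nat.DivMod using (_mod_; m%n<n; m<n⇒m%n≡m; m≤n⇒[n∸m]%m≡n%m)
open import Data.Nat.Properties
  using (≤-antisym; <-irrefl; <-≤-trans; <-≤-connex; +-cancelˡ-≡; +-identityʳ; +-mono-<;
         m∸n+n≡m; ∸-monoˡ-<; m+n∸n≡m)
open import Data.Product using (∃-syntax; _×_; _,_)
open import Data.Sum using (_⊎_; inj₁; inj₂; swap)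
open import Data.Sum.Properties using (inj₁-injective; inj₂-injective)
open import Function.Bundles using (_⇔_)
open import Level using (Level; 0ℓ)
open import Relation.Binary.Core using (Rel)
open import Relation.Binary.Definitions using (Decidable; Symmetric; Irreflexive)
open import Relation.Binary.PropositionalEquality using (_≡_; _≢_; refl; sym; trans; cong; subst)
open import Relation.Nullary using (¬_; no)
open import Relation.Nullary.Decidable using (map′; _⊎-dec_)

private variable
  ℓ : Level
  N n k d : ℕ

IsMinimum : (ℕ → Set ℓ) → ℕ → Set ℓ
IsMinimum P m = P m × (∀ j → P j → m ≤ j)

-- The invariants below are given as relations "m is the minimum of ...";
-- this fact makes them single-valued.
minimum-unique : {P : ℕ → Set ℓ} {a b : ℕ} → IsMinimum P a → IsMinimum P b → a ≡ b
minimum-unique (pa , a≤) (pb , b≤) = ≤-antisym (a≤ _ pb) (b≤ _ pa)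

record Graph (N : ℕ) : Set₁ where
  field
    Adj    : Rel (Fin N) 0ℓ
    sym-   : Symmetric Adj
    irrefl : Irreflexive _≡_ Adj
    adj?   : Decidable Adj

open Graph public

data Walk (G : Graph N) : ℕ → Fin N → Fin N → Set where
  []  : ∀ {x} → Walk G zero x x
  _∷_ : ∀ {x y z} → Adj G x y → Walk G d y z → Walk G (suc d) x z

-- If x and y lie in different components, then no d satisfies this
-- (the distance is infinite).
IsDistance : Graph N → Fin N → Fin N → ℕ → Set
IsDistance G x y = IsMinimum (λ d → Walk G d x y)

-- Equality of two distances, counting infinite distances as equal to each other.
EqualDistances : (G : Graph N) (x y x′ y′ : Fin N) → Set
EqualDistances G x y x′ y′ = ∀ d → IsDistance G x y d ⇔ IsDistance G x′ y′ d

Resolves : Graph N → Fin N → Fin N → Fin N → Set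
Resolves G w x y = ¬ EqualDistances G x w y w

IsResolvingSet : Graph N → Subset N → Set
IsResolvingSet G W = ∀ x y → x ≢ y → ∃[ w ] w ∈ W × Resolves G w x y

IsMetricDimension : Graph N → ℕ → Set
IsMetricDimension G = IsMinimum (λ m → ∃[ W ] IsResolvingSet G W × ∣ W ∣ ≡ m)

_SpanningSubgraphOf_ : Graph N → Graph N → Set
G SpanningSubgraphOf H = ∀ {x y} → Adj G x y → Adj H x y

IsThresholdDimension : Graph N → ℕ → Set₁
IsThresholdDimension G =
  IsMinimum (λ m → ∃[ H ] G SpanningSubgraphOf H × IsMetricDimension H m)

Irreducible : Graph N → Set₁
Irreducible G = ∃[ m ] IsThresholdDimension G m × IsMetricDimension G m

-- i ⊕ k is the index i + k modulo n.
infixl 6 _⊕_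
_⊕_ : Fin n → ℕ → Fin n
_⊕_ {n} i k = _mod_ (toℕ i + k) n {{nonZeroIndex i}}

⊕-moves : (i : Fin n) (k : ℕ) .{{_ : NonZero k}} → k < n → i ≢ i ⊕ k
⊕-moves {n} i k k<n i≡i⊕k = go (<-≤-connex (toℕ i + k) n)
  where
  instance
    n≢0 : NonZero n
    n≢0 = nonZeroIndex i

  eq : toℕ i ≡ (toℕ i + k) % n
  eq = trans (cong toℕ i≡i⊕k) (toℕ-fromℕ< (m%n<n (toℕ i + k) n))

  go : toℕ i + k < n ⊎ n ≤ toℕ i + k → _
  go (inj₁ lt) = ≢-nonZero⁻¹ k (sym (+-cancelˡ-≡ (toℕ i) 0 k
    (trans (+-identityʳ (toℕ i)) (trans eq (m<n⇒m%n≡m lt)))))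
  go (inj₂ ge) = <-irrefl (+-cancelˡ-≡ (toℕ i) k n i+k≡i+n) k<n
    where
    r : ℕ
    r = toℕ i + k ∸ n

    r<n : r < n
    r<n = subst (r <_) (m+n∸n≡m n n) (∸-monoˡ-< (+-mono-< (toℕ<n i) k<n) ge)

    i≡r : toℕ i ≡ r
    i≡r = trans eq (trans (sym (m≤n⇒[n∸m]%m≡n%m ge)) (m<n⇒m%n≡m r<n))

    i+k≡i+n : toℕ i + k ≡ toℕ i + n
    i+k≡i+n = trans (sym (m∸n+n≡m ge)) (cong (_+ n) (sym i≡r))

pattern u i = inj₁ i
pattern v i = inj₂ i

data PetersenEdge (n k : ℕ) : Rel (Fin n ⊎ Fin n) 0ℓ where
  outer : ∀ i → PetersenEdge n k (v i) (v (i ⊕ 1))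
  spoke : ∀ i → PetersenEdge n k (u i) (v i)
  inner : ∀ i → PetersenEdge n k (u i) (u (i ⊕ k))

petersenEdge? : Decidable (PetersenEdge n k)
petersenEdge? {k = k} (u i) (u j) =
  map′ (λ { refl → inner i }) (λ { (inner _) → refl }) (j ≟ i ⊕ k)
petersenEdge? (u i) (v j) = map′ (λ { refl → spoke i }) (λ { (spoke _) → refl }) (i ≟ j)
petersenEdge? (v i) (u j) = no λ ()
petersenEdge? (v i) (v j) = map′ (λ { refl → outer i }) (λ { (outer _) → refl }) (j ≟ i ⊕ 1)

petersenEdge-irrefl : .{{_ : NonZero k}} → k < n → Irreflexive _≡_ (PetersenEdge n k)
petersenEdge-irrefl {k} {n} k<n {x} refl e = loop e refl
  where
  1<n : 1 < n
  1<n = <-≤-trans (s≤s (>-nonZero⁻¹ k)) k<n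

  loop : ∀ {x y} → PetersenEdge n k x y → x ≢ y
  loop (outer i) p = ⊕-moves i 1 1<n (inj₂-injective p)
  loop (inner i) p = ⊕-moves i k k<n (inj₁-injective p)

-- The vertex set Fin (n + n) is identified with Fin n ⊎ Fin n by splitAt, the
-- first n vertices being the u's.  The bounds 0 < k < n only rule out loops.
P : (n k : ℕ) .{{_ : NonZero k}} → k < n → Graph (n + n)
P n k k<n = record
  { Adj    = λ x y → Edge (splitAt n x) (splitAt n y) ⊎ Edge (splitAt n y) (splitAt n x)
  ; sym-   = swap
  ; irrefl = λ { refl (inj₁ e) → petersenEdge-irrefl k<n refl e
               ; refl (inj₂ e) → petersenEdge-irrefl k<n refl e }
  ; adj?   = λ x y → petersenEdge? (splitAt n x) (splitAt n y)
               ⊎-dec petersenEdge? (splitAt n y) (splitAt n x)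
  }
  where Edge = PetersenEdge n k

{-# OPTIONS --safe #-}

-- Lower bound.  Let H ⊇ P(n,2) be resolved by a and b, and send a vertex x to
-- (d(x,a), d(x,b)); this map is injective, and along an edge neither coordinate
-- changes by more than 1.  At distance 1 from a there are thus at most 3
-- vertices, so the neighbours of a in H are its neighbours in P(n,2), and at
-- distance 2 there are at most 5.  Unless a lies on a triangle or a 4-cycle,
-- however, a has 6 second neighbours in P(n,2).  What remains is n = 6 or 8 with
-- a and b both on inner cycles: distances up to 2 are then the same in H as in
-- P(n,2), and for every such a, b some two vertices share theirs.
--
-- Upper bound.  Going around the cycle in either direction, two vertices whose
-- indices differ by δ are at distance min (g δ) (g (n − δ)), where g depends on
-- the kinds of the vertices only and, apart from a few small δ, grows by 1 as δ
-- grows by 2.  For n ≥ 8 the landmarks u₀, u₁ and v_c with c = ⌊n/2⌋ − 1 resolve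
-- P(n,2): once the parities of all indices are fixed, this says that finitely many systems of linear
-- inequalities in three integer unknowns have no solution, which is verified by
-- a reflective version of Gaussian and Fourier–Motzkin elimination.
module Submission where

open import Defs
open import Data.Nat using (ℕ; _≤_)
open import Data.Nat.Properties using (m+n≤o⇒n≤o)

-- Refutation of linear constraints over the integers by elimination.

module LinearArithmetic where

  open import Data.Bool using (Bool; true; false; T; not; _∧_; _∨_)
  open import Data.Bool.ListAction using (any; all)
  open import Data.Bool.Properties using (T-∧; T-∨)
  open import Data.Empty using (⊥)
  open import Data.Fin using (Fin; zero; suc)
  open import Data.Integer as ℤ using (ℤ; +_; -[1+_]; 0ℤ; -1ℤ; _+_; _*_; -_)
  import Data.Integer.Properties as ℤ
  open import Data.Integer.Tactic.RingSolver using (solve-∀)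
  open import Data.List using (List; []; _∷_; _++_; map; mapMaybe; concatMap; filterᵇ)
  open import Data.List.Relation.Unary.All as All using (All; []; _∷_)
  import Data.List.Relation.Unary.All.Properties as All
  open import Data.List.Relation.Unary.Any using (Any; here; there)
  open import Data.Maybe using (Maybe; just; nothing)
  open import Data.Nat using (zero; suc)
  open import Data.Product using (_×_; _,_; proj₁; proj₂)
  open import Data.Sum using (inj₁; inj₂)
  open import Data.Vec as Vec using (Vec; []; _∷_; zipWith)
  open import Function.Base using (_∘_)
  open import Function.Bundles using (module Equivalence)
  open import Relation.Binary.PropositionalEquality using (_≡_; refl; sym; trans; cong; subst; module ≡-Reasoning)
  open import Relation.Nullary using (¬_)

  -- a₁ ∷ … ∷ aₙ ∷ c ∷ [] stands for a₁ x₁ + … + aₙ xₙ + c.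
  Lin : ℕ → Set
  Lin n = Vec ℤ (suc n)

  ⟦_⟧ : ∀ {n} → Lin n → Vec ℤ n → ℤ
  ⟦_⟧ {zero}  (c ∷ []) []      = c
  ⟦_⟧ {suc n} (a ∷ p)  (x ∷ ρ) = a * x + ⟦ p ⟧ ρ

  lincomb : ∀ {n} → ℤ → Vec ℤ n → ℤ → Vec ℤ n → Vec ℤ n
  lincomb a p b q = zipWith (λ x y → a * x + b * y) p q

  ⟦lincomb⟧ : ∀ {n} a (p : Lin n) b q ρ → ⟦ lincomb a p b q ⟧ ρ ≡ a * ⟦ p ⟧ ρ + b * ⟦ q ⟧ ρ
  ⟦lincomb⟧ a (c ∷ []) b (d ∷ []) []      = refl
  ⟦lincomb⟧ a (c ∷ p)  b (d ∷ q)  (x ∷ ρ) =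
    trans (cong (λ z → (a * c + b * d) * x + z) (⟦lincomb⟧ a p b q ρ))
          (rearrange a b c d x (⟦ p ⟧ ρ) (⟦ q ⟧ ρ))
    where
    rearrange : ∀ a b c d x P Q → (a * c + b * d) * x + (a * P + b * Q)
                                ≡ a * (c * x + P) + b * (d * x + Q)
    rearrange = solve-∀

  record System (n : ℕ) : Set where
    constructor _&_
    field
      equations    : List (Lin n)
      inequalities : List (Lin n)

  _⊨₀_ _⊨₊_ : ∀ {n} → Vec ℤ n → Lin n → Set
  ρ ⊨₀ p = ⟦ p ⟧ ρ ≡ 0ℤ
  ρ ⊨₊ p = 0ℤ ℤ.≤ ⟦ p ⟧ ρ

  infix 4 _⊨_
  _⊨_ : ∀ {n} → Vec ℤ n → System n → Set
  ρ ⊨ (es & is) = All (ρ ⊨₀_) es × All (ρ ⊨₊_) is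

  -- The first equation in which the leading variable occurs, with sign
  -- normalised: (a , p) stands for (1 + a) x + p = 0.
  pivot : ∀ {n} → List (Lin (suc n)) → Maybe (ℕ × Lin n)
  pivot []                    = nothing
  pivot ((+ zero   ∷ p) ∷ es) = pivot es
  pivot ((+ suc a  ∷ p) ∷ es) = just (a , p)
  pivot ((-[1+ a ] ∷ p) ∷ es) = just (a , Vec.map (-_) p)

  -- The result is `1 + a` times the constraint minus `b` times the pivot equation. No division
  -- occurs, and the positive factor preserves inequalities as well as equations.
  substitute : ∀ {n} → ℕ → Lin n → Lin (suc n) → Lin n
  substitute a e (b ∷ p) = lincomb (+ suc a) p (- b) e

  lower upper : ∀ {n} → Lin (suc n) → Maybe (ℕ × Lin n)
  lower (+ suc a  ∷ p) = just (a , p)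
  lower _              = nothing
  upper (-[1+ a ] ∷ p) = just (a , p)
  upper _              = nothing

  neither : ∀ {n} → Lin (suc n) → Maybe (Lin n)
  neither (+ zero ∷ p) = just p
  neither _            = nothing

  -- Constant inequalities that hold anyway. Dropping them curbs the growth of the elimination and
  -- cannot harm soundness.
  trivial : ∀ {n} → Lin n → Bool
  trivial {zero}  (+ _      ∷ []) = true
  trivial {suc n} (+ zero   ∷ p)  = trivial p
  trivial         _               = false

  -- Fourier–Motzkin elimination of the leading variable.
  eliminate : ∀ {n} → List (Lin (suc n)) → List (Lin n)
  eliminate is =
    mapMaybe neither is ++
    filterᵇ (not ∘ trivial)
      (concatMap (λ (a , p) → map (λ (b , q) → lincomb (+ suc b) p (+ suc a) q) (mapMaybe upper is))
                 (mapMaybe lower is))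

  nonzero negative : Lin 0 → Bool
  nonzero  (+ zero   ∷ []) = false
  nonzero  (+ suc _  ∷ []) = true
  nonzero  (-[1+ _ ] ∷ []) = true
  negative (+ _      ∷ []) = false
  negative (-[1+ _ ] ∷ []) = true

  refute : ∀ {n} → System n → Bool
  refute {zero}  (es & is) = any nonzero es ∨ any negative is
  refute {suc n} (es & is) with pivot es
  -- The pivot equation itself turns into 0 = 0 and can stay in the list.
  ... | just (a , e) = refute (map (substitute a e) es & map (substitute a e) is)
  -- Without a pivot every leading coefficient in `es` is 0, so `Vec.tail` loses nothing.
  ... | nothing      = refute (map Vec.tail es & eliminate is)

  Clause : ℕ → Set
  Clause n = List (System n)

  _∪ˢ_ : ∀ {n} → System n → System n → System n
  (es & is) ∪ˢ (es′ & is′) = (es ++ es′) & (is ++ is′)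

  -- A clause is a disjunction of systems. Trying `refute` before each split prunes branches that
  -- are already contradictory.
  refuteSplit : ∀ {n} → List (Clause n) → System n → Bool
  refuteSplit []       s = refute s
  refuteSplit (c ∷ cs) s = refute s ∨ all (λ s′ → refuteSplit cs (s′ ∪ˢ s)) c

  ⟦neg⟧ : ∀ {n} (p : Lin n) ρ → ⟦ Vec.map (-_) p ⟧ ρ ≡ - ⟦ p ⟧ ρ
  ⟦neg⟧ (c ∷ [])        []      = refl
  ⟦neg⟧ (a ∷ p) (x ∷ ρ) =
    trans (cong (λ z → - a * x + z) (⟦neg⟧ p ρ)) (rearrange a x (⟦ p ⟧ ρ))
    where
    rearrange : ∀ a x P → - a * x + - P ≡ - (a * x + P)
    rearrange = solve-∀

  pivot-sound : ∀ {n} (es : List (Lin (suc n))) {a p} → pivot es ≡ just (a , p) →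
                ∀ x ρ → All ((x ∷ ρ) ⊨₀_) es → + suc a * x + ⟦ p ⟧ ρ ≡ 0ℤ
  pivot-sound ((+ zero   ∷ p) ∷ es) eq   x ρ (_ ∷ hs) = pivot-sound es eq x ρ hs
  pivot-sound ((+ suc a  ∷ p) ∷ es) refl x ρ (h ∷ _)  = h
  pivot-sound ((-[1+ a ] ∷ p) ∷ es) refl x ρ (h ∷ _)  = begin
    + suc a * x + ⟦ Vec.map (-_) p ⟧ ρ ≡⟨ cong (λ z → + suc a * x + z) (⟦neg⟧ p ρ) ⟩
    + suc a * x + - ⟦ p ⟧ ρ            ≡⟨ rearrange (+ suc a) x (⟦ p ⟧ ρ) ⟩
    - (-[1+ a ] * x + ⟦ p ⟧ ρ)         ≡⟨ cong (-_) h ⟩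
    0ℤ                                  ∎
    where
    open ≡-Reasoning
    rearrange : ∀ a x P → a * x + - P ≡ - (- a * x + P)
    rearrange = solve-∀

  pivot-nothing : ∀ {n} (es : List (Lin (suc n))) → pivot es ≡ nothing →
                  ∀ x ρ → All ((x ∷ ρ) ⊨₀_) es → All (ρ ⊨₀_) (map Vec.tail es)
  pivot-nothing []                             eq x ρ []       = []
  pivot-nothing ((+ zero   ∷ p) ∷ es) eq x ρ (h ∷ hs) =
    trans (rearrange x (⟦ p ⟧ ρ)) h ∷ pivot-nothing es eq x ρ hs
    where
    rearrange : ∀ x P → P ≡ 0ℤ * x + P
    rearrange = solve-∀

  ⟦substitute⟧ : ∀ {n} a (e : Lin n) x ρ → + suc a * x + ⟦ e ⟧ ρ ≡ 0ℤ →
                 ∀ p → ⟦ substitute a e p ⟧ ρ ≡ + suc a * ⟦ p ⟧ (x ∷ ρ)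
  ⟦substitute⟧ a e x ρ h (b ∷ p) = begin
    ⟦ lincomb (+ suc a) p (- b) e ⟧ ρ
      ≡⟨ ⟦lincomb⟧ (+ suc a) p (- b) e ρ ⟩
    + suc a * ⟦ p ⟧ ρ + - b * ⟦ e ⟧ ρ
      ≡⟨ rearrange (+ suc a) b x (⟦ p ⟧ ρ) (⟦ e ⟧ ρ) ⟩
    + suc a * (b * x + ⟦ p ⟧ ρ) + - b * (+ suc a * x + ⟦ e ⟧ ρ)
      ≡⟨ cong (λ z → + suc a * (b * x + ⟦ p ⟧ ρ) + - b * z) h ⟩
    + suc a * (b * x + ⟦ p ⟧ ρ) + - b * 0ℤ
      ≡⟨ vanish (+ suc a * (b * x + ⟦ p ⟧ ρ)) b ⟩
    + suc a * (b * x + ⟦ p ⟧ ρ) ∎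
    where
    open ≡-Reasoning
    rearrange : ∀ a b x P E → a * P + - b * E ≡ a * (b * x + P) + - b * (a * x + E)
    rearrange = solve-∀
    vanish : ∀ y b → y + - b * 0ℤ ≡ y
    vanish = solve-∀

  0≤k*i : ∀ k {i} → 0ℤ ℤ.≤ i → 0ℤ ℤ.≤ + k * i
  0≤k*i k {i} h = subst (ℤ._≤ + k * i) (ℤ.*-zeroʳ (+ k)) (ℤ.*-monoˡ-≤-nonNeg (+ k) h)

  mapMaybe⁺ : ∀ {A B : Set} {P : A → Set} {Q : B → Set} (f : A → Maybe B) →
              (∀ x {y} → f x ≡ just y → P x → Q y) → ∀ {xs} → All P xs → All Q (mapMaybe f xs)
  mapMaybe⁺ f h {[]}     []         = []
  mapMaybe⁺ f h {x ∷ xs} (px ∷ pxs) with f x in eq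
  ... | just y  = h x eq px ∷ mapMaybe⁺ f h pxs
  ... | nothing = mapMaybe⁺ f h pxs

  module _ {n} (x : ℤ) (ρ : Vec ℤ n) where

    neither-sound : ∀ p {q} → neither p ≡ just q → (x ∷ ρ) ⊨₊ p → ρ ⊨₊ q
    neither-sound (+ zero ∷ p) refl h = subst (0ℤ ℤ.≤_) (rearrange x (⟦ p ⟧ ρ)) h
      where
      rearrange : ∀ x P → 0ℤ * x + P ≡ P
      rearrange = solve-∀

    lower-sound : ∀ p {q} → lower p ≡ just q → (x ∷ ρ) ⊨₊ p → 0ℤ ℤ.≤ + suc (proj₁ q) * x + ⟦ proj₂ q ⟧ ρ
    lower-sound (+ suc a ∷ (_ ∷ _)) refl h = h

    upper-sound : ∀ p {q} → upper p ≡ just q → (x ∷ ρ) ⊨₊ p → 0ℤ ℤ.≤ -[1+ proj₁ q ] * x + ⟦ proj₂ q ⟧ ρ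
    upper-sound (-[1+ a ] ∷ (_ ∷ _)) refl h = h

    -- The multipliers `1 + b` and `1 + a` are positive and chosen so that the terms in `x` cancel
    -- in the sum.
    cross-sound : ∀ a p b q → 0ℤ ℤ.≤ + suc a * x + ⟦ p ⟧ ρ → 0ℤ ℤ.≤ -[1+ b ] * x + ⟦ q ⟧ ρ →
                  ρ ⊨₊ lincomb (+ suc b) p (+ suc a) q
    cross-sound a p b q hp hq =
      subst (0ℤ ℤ.≤_) (sym (trans (⟦lincomb⟧ (+ suc b) p (+ suc a) q ρ)
                                (rearrange (+ suc a) (+ suc b) x (⟦ p ⟧ ρ) (⟦ q ⟧ ρ))))
        (ℤ.+-mono-≤ (0≤k*i (suc b) hp) (0≤k*i (suc a) hq))
      where
      rearrange : ∀ a b x P Q → b * P + a * Q ≡ b * (a * x + P) + a * (- b * x + Q)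
      rearrange = solve-∀

    eliminate-sound : ∀ {is} → All ((x ∷ ρ) ⊨₊_) is → All (ρ ⊨₊_) (eliminate is)
    eliminate-sound hs = All.++⁺ (mapMaybe⁺ neither neither-sound hs)
      (All.filter⁺ _ (All.concat⁺ (All.map⁺ (All.map
        (λ { {a , p} hp → All.map⁺ (All.map (λ { {b , q} hq → cross-sound a p b q hp hq }) (mapMaybe⁺ upper upper-sound hs)) })
        (mapMaybe⁺ lower lower-sound hs)))))

  any-nonzero-sound : ∀ {es} → T (any nonzero es) → ¬ All ([] ⊨₀_) es
  any-nonzero-sound {(+ zero ∷ []) ∷ _} t (_ ∷ hs) = any-nonzero-sound t hs
  any-nonzero-sound {(+ suc _ ∷ []) ∷ _} t (() ∷ _)
  any-nonzero-sound {(-[1+ _ ] ∷ []) ∷ _} t (() ∷ _)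

  any-negative-sound : ∀ {is} → T (any negative is) → ¬ All ([] ⊨₊_) is
  any-negative-sound {(+ _ ∷ []) ∷ _} t (_ ∷ hs) = any-negative-sound t hs
  any-negative-sound {(-[1+ _ ] ∷ []) ∷ _} t (() ∷ _)

  refute-sound : ∀ {n} (s : System n) → T (refute s) → ∀ ρ → ¬ ρ ⊨ s
  refute-sound {zero}  (es & is) t [] (he , hi) with Equivalence.to (T-∨ {any nonzero es}) t
  ... | inj₁ t′ = any-nonzero-sound t′ he
  ... | inj₂ t′ = any-negative-sound t′ hi
  refute-sound {suc n} (es & is) t (x ∷ ρ) (he , hi) with pivot es in eq
  ... | nothing = refute-sound _ t ρ (pivot-nothing es eq x ρ he , eliminate-sound x ρ hi)
  ... | just (a , e) = refute-sound _ t ρ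
    ( All.map⁺ (All.map (λ {p} h → trans (subst-value p) (trans (cong (+ suc a *_) h) (ℤ.*-zeroʳ (+ suc a)))) he)
    , All.map⁺ (All.map (λ {p} h → subst (0ℤ ℤ.≤_) (sym (subst-value p)) (0≤k*i (suc a) h)) hi))
    where
    subst-value : ∀ p → ⟦ substitute a e p ⟧ ρ ≡ + suc a * ⟦ p ⟧ (x ∷ ρ)
    subst-value = ⟦substitute⟧ a e x ρ (pivot-sound es eq x ρ he)

  ∪ˢ-sound : ∀ {n} {ρ : Vec ℤ n} {s s′} → ρ ⊨ s → ρ ⊨ s′ → ρ ⊨ (s ∪ˢ s′)
  ∪ˢ-sound (he , hi) (he′ , hi′) = All.++⁺ he he′ , All.++⁺ hi hi′

  refuteSplit-sound : ∀ {n} (cs : List (Clause n)) s → T (refuteSplit cs s) →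
                      ∀ ρ → All (Any (ρ ⊨_)) cs → ¬ ρ ⊨ s
  refuteSplit-sound []       s t ρ []       hs = refute-sound s t ρ hs
  refuteSplit-sound (c ∷ cs) s t ρ (h ∷ hc) hs with Equivalence.to (T-∨ {refute s}) t
  ... | inj₁ t′ = refute-sound s t′ ρ hs
  ... | inj₂ t′ = branch c t′ h
    where
    branch : ∀ c → T (all (λ s′ → refuteSplit cs (s′ ∪ˢ s)) c) → Any (ρ ⊨_) c → ⊥
    branch (s′ ∷ c) t (here h)  = refuteSplit-sound cs (s′ ∪ˢ s) (proj₁ (Equivalence.to T-∧ t)) ρ hc (∪ˢ-sound h hs)
    branch (s′ ∷ c) t (there h) = branch c (proj₂ (Equivalence.to (T-∧ {refuteSplit cs (s′ ∪ˢ s)}) t)) h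

  infixl 6 _⊞_ _⊟_

  con : ∀ {n} → ℤ → Lin n
  con {zero}  c = c ∷ []
  con {suc n} c = 0ℤ ∷ con c

  var : ∀ {n} → Fin n → Lin n
  var zero    = + 1 ∷ con 0ℤ
  var (suc i) = 0ℤ ∷ var i

  _⊞_ _⊟_ : ∀ {n} → Lin n → Lin n → Lin n
  p ⊞ q = lincomb (+ 1) p (+ 1) q
  p ⊟ q = lincomb (+ 1) p -1ℤ q

  module _ where
    private
      0x+P : ∀ x P → 0ℤ * x + P ≡ P
      0x+P = solve-∀

      1x+0 : ∀ x → + 1 * x + 0ℤ ≡ x
      1x+0 = solve-∀

      1x+1y : ∀ x y → + 1 * x + + 1 * y ≡ x + y
      1x+1y = solve-∀

      1x-1y : ∀ x y → + 1 * x + -1ℤ * y ≡ x + - y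
      1x-1y = solve-∀

    ⟦con⟧ : ∀ {n} c (ρ : Vec ℤ n) → ⟦ con c ⟧ ρ ≡ c
    ⟦con⟧ c []              = refl
    ⟦con⟧ c (x ∷ ρ) = trans (0x+P x _) (⟦con⟧ c ρ)

    ⟦var⟧ : ∀ {n} i (ρ : Vec ℤ n) → ⟦ var i ⟧ ρ ≡ Vec.lookup ρ i
    ⟦var⟧ zero    (x ∷ ρ) = trans (cong (λ z → + 1 * x + z) (⟦con⟧ 0ℤ ρ)) (1x+0 x)
    ⟦var⟧ (suc i) (x ∷ ρ) = trans (0x+P x _) (⟦var⟧ i ρ)

    ⟦⊞⟧ : ∀ {n} (p q : Lin n) ρ → ⟦ p ⊞ q ⟧ ρ ≡ ⟦ p ⟧ ρ + ⟦ q ⟧ ρ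
    ⟦⊞⟧ p q ρ = trans (⟦lincomb⟧ (+ 1) p (+ 1) q ρ) (1x+1y (⟦ p ⟧ ρ) (⟦ q ⟧ ρ))

    ⟦⊟⟧ : ∀ {n} (p q : Lin n) ρ → ⟦ p ⊟ q ⟧ ρ ≡ ⟦ p ⟧ ρ + - ⟦ q ⟧ ρ
    ⟦⊟⟧ p q ρ = trans (⟦lincomb⟧ (+ 1) p -1ℤ q ρ) (1x-1y (⟦ p ⟧ ρ) (⟦ q ⟧ ρ))

open import Data.Bool using (Bool; true; false; T; not; _∧_; _xor_; if_then_else_)
open import Data.Bool.Properties using (T-∧)
open import Data.Empty using (⊥; ⊥-elim)
open import Data.Fin as Fin using (Fin; zero; suc; toℕ; splitAt; join; fromℕ<; #_)
import Data.Fin.Properties as Fin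
open import Data.Fin.Subset using (Subset; _∈_; ∣_∣; _∪_; ⁅_⁆; inside; outside) renaming (_-_ to _without_)
open import Data.Fin.Subset.Properties using (nonempty?; x∈p∧x≢y⇒x∈p-y; x∈p⇒∣p-x∣<∣p∣; x∈⁅x⁆; ∣⁅x⁆∣≡1; p⊆p∪q; q⊆p∪q)
open import Data.Nat hiding (_≟_; ℕ; _≤_)
open import Data.Nat.DivMod
open import Data.Nat.Properties hiding (_≟_; m+n≤o⇒n≤o)
import Data.Nat.Properties as ℕ
open import Data.Product as Product using (∃; ∃₂; ∃-syntax; _×_; _,_; proj₁; proj₂)
open import Data.Product.Properties using (≡-dec)
open import Data.Sum using (_⊎_; inj₁; inj₂)
open import Data.Sum.Properties using (inj₁-injective; inj₂-injective)
open import Data.Vec using (Vec; []; _∷_; lookup)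
import Data.Vec.Functional as Functional
open import Function.Base using (_∘_; flip; id; case_of_)
open import Function.Bundles using (mk⇔; module Equivalence)
open import Function.Definitions using (Injective)
open import Relation.Binary.Definitions using (DecidableEquality; tri<; tri≈; tri>)
open import Relation.Binary.PropositionalEquality using (_≡_; _≢_; refl; sym; trans; cong; cong₂; subst; subst₂; module ≡-Reasoning)
open import Relation.Nullary using (¬_; Dec; yes; no)
open import Relation.Nullary.Decidable using (map′; _×-dec_; _→-dec_; ¬?; from-yes; decidable-stable)

private variable
  N n k d : ℕ
  G : Graph N
  x y z : Fin N

-- Walks and the distance formula for P(n,2).

_∷ʳ_ : Walk G d x y → Adj G y z → Walk G (suc d) x z
[]      ∷ʳ f = f ∷ []
(e ∷ p) ∷ʳ f = e ∷ (p ∷ʳ f)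

reverse : Walk G d x y → Walk G d y x
reverse         []      = []
reverse {G = G} (e ∷ p) = reverse p ∷ʳ sym- G e

data Kind : Set where
  U V : Kind

-- In closed form, ⌊δ/2⌋ plus `p` for even δ and plus `q` for odd δ: an inner edge advances the
-- index by 2.
ramp : ℕ → ℕ → ℕ → ℕ
ramp p q zero          = p
ramp p q (suc zero)    = q
ramp p q (suc (suc δ)) = suc (ramp p q δ)

ramp-suc : ∀ p q δ → ramp (suc p) (suc q) δ ≡ suc (ramp p q δ)
ramp-suc p q zero          = refl
ramp-suc p q (suc zero)    = refl
ramp-suc p q (suc (suc δ)) = cong suc (ramp-suc p q δ)

-- The distance in the infinite graph P(∞,2) between vertices of the given
-- kinds whose indices differ by δ.
profile : Kind → Kind → ℕ → ℕ
profile U U δ = ramp 0 3 δ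
profile U V δ = ramp 1 2 δ
profile V U δ = ramp 1 2 δ
profile V V δ = δ ⊓ ramp 2 3 δ

profile-comm : ∀ t s δ → profile t s δ ≡ profile s t δ
profile-comm U U δ = refl
profile-comm U V δ = refl
profile-comm V U δ = refl
profile-comm V V δ = refl

cyclic : ℕ → (ℕ → ℕ) → ℕ → ℕ
cyclic n f δ = f δ ⊓ f (n ∸ δ)

dist : ℕ → Kind × ℕ → Kind × ℕ → ℕ
dist n (t , i) (s , c) = cyclic n (profile t s) ∣ i - c ∣

Close : ℕ → ℕ → Set
Close a b = a ≤ suc b × b ≤ suc a

close-refl : ∀ {a} → Close a a
close-refl = n≤1+n _ , n≤1+n _

close-suc : ∀ {a} → Close a (suc a)
close-suc = m≤n⇒m≤1+n (n≤1+n _) , ≤-refl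

close-sym : ∀ {a b} → Close a b → Close b a
close-sym (p , q) = q , p

close-⊓ : ∀ {a b c d} → Close a b → Close c d → Close (a ⊓ c) (b ⊓ d)
close-⊓ (p , q) (p′ , q′) = ⊓-mono-≤ p p′ , ⊓-mono-≤ q q′

cyclic-comm : ∀ {n δ} f → δ ≤ n → cyclic n f (n ∸ δ) ≡ cyclic n f δ
cyclic-comm {n} {δ} f δ≤n rewrite m∸[m∸n]≡n δ≤n = ⊓-comm (f (n ∸ δ)) (f δ)

-- One way round, the index difference grows by `k`; the other way round it shrinks by `k`, from
-- `n ∸ δ` to `n ∸ (k + δ)`. The hypothesis on `f` bounds both changes, and the minimum inherits the
-- bound.
cyclic-close : ∀ {n k δ} f → (∀ δ → Close (f δ) (f (k + δ))) → k + δ ≤ n →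
               Close (cyclic n f δ) (cyclic n f (k + δ))
cyclic-close {n} {k} {δ} f h k+δ≤n = close-⊓ (h δ)
  (close-sym (subst (λ z → Close (f (n ∸ (k + δ))) (f z)) eq (h (n ∸ (k + δ)))))
  where
  eq : k + (n ∸ (k + δ)) ≡ n ∸ δ
  eq = begin
    k + (n ∸ (k + δ)) ≡⟨ +-∸-assoc k k+δ≤n ⟨
    k + n ∸ (k + δ)   ≡⟨ [m+n]∸[m+o]≡n∸o k n δ ⟩
    n ∸ δ             ∎
    where open ≡-Reasoning

-- Of the two lemmas below, only `gap₂` produces `flat`, namely when `c` is `i + 1`, halfway along
-- the step.
data Gap (k : ℕ) : ℕ → ℕ → Set where
  up   : ∀ {δ} → Gap k δ (k + δ)
  down : ∀ {δ} → Gap k (k + δ) δ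
  flat : ∀ {δ} → Gap k δ δ

gap₁ : ∀ i c → Gap 1 ∣ i - c ∣ ∣ suc i - c ∣
gap₁ i       zero    rewrite ∣-∣-identityʳ i = up
gap₁ zero    (suc c) = down
gap₁ (suc i) (suc c) = gap₁ i c

gap₂ : ∀ i c → Gap 2 ∣ i - c ∣ ∣ 2 + i - c ∣
gap₂ i       zero          rewrite ∣-∣-identityʳ i = up
gap₂ zero    (suc zero)    = flat
gap₂ zero    (suc (suc c)) = down
gap₂ (suc i) (suc c)       = gap₂ i c

gap-close : ∀ {n k δ δ′} f → (∀ δ → Close (f δ) (f (k + δ))) → δ ≤ n → δ′ ≤ n → Gap k δ δ′ →
            Close (cyclic n f δ) (cyclic n f δ′)
gap-close f h δ≤n δ′≤n up   = cyclic-close f h δ′≤n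
gap-close f h δ≤n δ′≤n down = close-sym (cyclic-close f h δ≤n)
gap-close f h δ≤n δ′≤n flat = close-refl

∣-∣-≤ : ∀ {i c} → i < n → c < n → ∣ i - c ∣ ≤ n
∣-∣-≤ {i = i} {c} i<n c<n = ≤-trans (∣m-n∣≤m⊔n i c) (⊔-lub (<⇒≤ i<n) (<⇒≤ c<n))

-- The two index differences are 1 and `n ∸ 1`, which `cyclic` interchanges, so the two values are
-- equal.
halfway-close : ∀ {n k i c} .{{_ : NonZero n}} f → n ≡ 2 + i → c ≡ suc i → k ≡ 2 →
                Close (cyclic n f ∣ i - c ∣) (cyclic n f ∣ (k + i) % n - c ∣)
halfway-close {i = i} f refl refl refl
  rewrite n%n≡0 (2 + i) {{_}} | m≤n⇒∣m-n∣≡n∸m (n≤1+n i) | m+n∸n≡m 1 i | ⊓-comm (f (suc i)) (f 1) = close-refl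

rotation-close : ∀ {n k} .{{_ : NonZero n}} f → k ≤ 2 → k < n → (∀ i c → Gap k ∣ i - c ∣ ∣ k + i - c ∣) →
                 (∀ δ → Close (f δ) (f (k + δ))) → ∀ {i c} → i < n → c < n →
                 Close (cyclic n f ∣ i - c ∣) (cyclic n f ∣ (k + i) % n - c ∣)
rotation-close {n} {k} f k≤2 k<n gap h {i} {c} i<n c<n with <-≤-connex (k + i) n
... | inj₁ k+i<n rewrite m<n⇒m%n≡m k+i<n = gap-close f h (∣-∣-≤ i<n c<n) (∣-∣-≤ k+i<n c<n) (gap i c)
... | inj₂ n≤k+i = wrap
  where
  i′ : ℕ
  i′ = (k + i) % n

  i′≡ : n + i′ ≡ k + i
  i′≡ = begin
    n + (k + i) % n       ≡⟨ cong (n +_) (m≤n⇒[n∸m]%m≡n%m n≤k+i) ⟨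
    n + (k + i ∸ n) % n   ≡⟨ cong (n +_) (m<n⇒m%n≡m k+i∸n<n) ⟩
    n + (k + i ∸ n)       ≡⟨ m+[n∸m]≡n n≤k+i ⟩
    k + i                 ∎
    where
    open ≡-Reasoning
    k+i∸n<n : k + i ∸ n < n
    k+i∸n<n = subst (k + i ∸ n <_) (m+n∸n≡m n n) (∸-monoˡ-< (+-mono-< k<n i<n) n≤k+i)

  wrap : Close (cyclic n f ∣ i - c ∣) (cyclic n f ∣ i′ - c ∣)
  wrap with <-≤-connex i c
  -- Seen from c + n, which is congruent to c, the step from i to i + k does not wrap around.
  ... | inj₂ c≤i = subst₂ (λ y z → Close y (cyclic n f z))
        (trans (cong (cyclic n f) across) (cyclic-comm f (∣-∣-≤ {i = i} {c} i<n c<n)))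
        (trans (cong (λ z → ∣ z - n + c ∣) (sym i′≡)) (∣m+n-m+o∣≡∣n-o∣ n i′ c))
        (gap-close f h (subst (_≤ n) (sym across) (m∸n≤m n ∣ i - c ∣))
          (subst (_≤ n) (trans (sym (∣m+n-m+o∣≡∣n-o∣ n i′ c)) (cong (λ z → ∣ z - n + c ∣) i′≡))
            (∣-∣-≤ (m%n<n (k + i) n) c<n))
          (gap i (n + c)))
    where
    open ≡-Reasoning
    across : ∣ i - n + c ∣ ≡ n ∸ ∣ i - c ∣
    across = begin
      ∣ i - n + c ∣             ≡⟨ m≤n⇒∣m-n∣≡n∸m (≤-trans (<⇒≤ i<n) (m≤m+n n c)) ⟩
      n + c ∸ i                 ≡⟨ cong₂ _∸_ (+-comm n c) (sym (m+[n∸m]≡n c≤i)) ⟩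
      c + n ∸ (c + (i ∸ c))     ≡⟨ [m+n]∸[m+o]≡n∸o c n (i ∸ c) ⟩
      n ∸ (i ∸ c)               ≡⟨ cong (n ∸_) (m≤n⇒∣n-m∣≡n∸m c≤i) ⟨
      n ∸ ∣ i - c ∣             ∎
  -- Here k = 2, and c = n − 1 lies halfway between i = n − 2 and i + k = n.
  ... | inj₁ i<c = halfway-close f (≤-antisym (≤-trans n≤k+i (+-monoˡ-≤ i k≤2)) 2+i≤n)
        (≤-antisym (s≤s⁻¹ (≤-trans c<n (≤-trans n≤k+i (+-monoˡ-≤ i k≤2)))) i<c)
        (≤-antisym k≤2 (+-cancelʳ-≤ i 2 k (≤-trans 2+i≤n n≤k+i)))
    where
    2+i≤n : 2 + i ≤ n
    2+i≤n = ≤-trans (s≤s i<c) c<n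

side : Kind → Fin n → Fin n ⊎ Fin n
side U = inj₁
side V = inj₂

label : Fin n ⊎ Fin n → Kind × ℕ
label (u i) = U , toℕ i
label (v i) = V , toℕ i

label< : ∀ (a : Fin n ⊎ Fin n) → proj₂ (label a) < n
label< (u i) = Fin.toℕ<n i
label< (v i) = Fin.toℕ<n i

coordinates : Fin (n + n) → Kind × ℕ
coordinates {n} x = label (splitAt n x)

distance : Fin (n + n) → Fin (n + n) → ℕ
distance {n} x w = dist n (coordinates {n} x) (coordinates {n} w)

ramp-close : ∀ p q → Close p q → Close (suc p) q → ∀ δ → Close (ramp p q δ) (ramp p q (suc δ))
ramp-close p q h h′ zero          = h
ramp-close p q h h′ (suc zero)    = close-sym h′
ramp-close p q h h′ (suc (suc δ)) = Product.map s≤s s≤s (ramp-close p q h h′ δ)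

profile-V-close : ∀ s δ → Close (profile V s δ) (profile V s (1 + δ))
profile-V-close U δ = ramp-close 1 2 close-suc close-refl δ
profile-V-close V δ = close-⊓ (close-suc {δ}) (ramp-close 2 3 close-suc close-refl δ)

profile-UV-close : ∀ s δ → Close (profile U s δ) (profile V s δ)
profile-UV-close U zero          = close-suc
profile-UV-close U (suc zero)    = close-sym close-suc
profile-UV-close U (suc (suc δ)) = Product.map s≤s s≤s (profile-UV-close U δ)
-- `ramp 2 3 δ` exceeds `ramp 1 2 δ` by one, the price of one more spoke. The term for the outer
-- cycle needs the separate bound `ramp-1-2≤`.
profile-UV-close V δ =
  ⊓-glb (ramp-1-2≤ δ) (≤-trans (≤-trans (n≤1+n _) (≤-reflexive (sym (ramp-suc 1 2 δ)))) (n≤1+n _)) ,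
  ≤-trans (m⊓n≤n δ (ramp 2 3 δ)) (≤-reflexive (ramp-suc 1 2 δ))
  where
  ramp-1-2≤ : ∀ δ → ramp 1 2 δ ≤ suc δ
  ramp-1-2≤ zero          = ≤-refl
  ramp-1-2≤ (suc zero)    = ≤-refl
  ramp-1-2≤ (suc (suc δ)) = ≤-trans (s≤s (ramp-1-2≤ δ)) (n≤1+n _)

profile-U-close : ∀ s δ → Close (profile U s δ) (profile U s (2 + δ))
profile-U-close U δ = close-suc
profile-U-close V δ = close-suc

module _ (2<n : 2 < n) where

  private
    G₂ : Graph (n + n)
    G₂ = P n 2 2<n

    instance
      n≢0 : NonZero n
      n≢0 = >-nonZero (≤-trans z<s 2<n)

  -- Reading any natural number as an index modulo `n` lets walks of the infinite graph project to
  -- P(n,2) without a case distinction where indices wrap around.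
  vertex : Kind → ℕ → Fin (n + n)
  vertex t i = join n n (side t (i mod n))

  edge⇒adj : ∀ {a b} → PetersenEdge n 2 a b → Adj G₂ (join n n a) (join n n b)
  edge⇒adj {a} {b} e rewrite Fin.splitAt-join n n a | Fin.splitAt-join n n b = inj₁ e

  toℕ-⊕ : ∀ (i : Fin n) k → toℕ (i ⊕ k) ≡ (k + toℕ i) % n
  toℕ-⊕ i k = trans (Fin.toℕ-fromℕ< _) (cong (_% n) (+-comm (toℕ i) k))

  mod-⊕ : ∀ i k → (i mod n) ⊕ k ≡ (k + i) mod n
  mod-⊕ i k = Fin.fromℕ<-cong _ _ (begin
    (toℕ (i mod n) + k) % n       ≡⟨ cong (λ z → (z + k) % n) (Fin.toℕ-fromℕ< (m%n<n i n)) ⟩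
    (i % n + k) % n               ≡⟨ %-distribˡ-+ (i % n) k n ⟩
    (i % n % n + k % n) % n       ≡⟨ cong (λ z → (z + k % n) % n) (m%n%n≡m%n i n) ⟩
    (i % n + k % n) % n           ≡⟨ %-distribˡ-+ i k n ⟨
    (i + k) % n                   ≡⟨ cong (_% n) (+-comm i k) ⟩
    (k + i) % n                   ∎) _ _
    where open ≡-Reasoning

  spoke-adj : ∀ i → Adj G₂ (vertex U i) (vertex V i)
  spoke-adj i = edge⇒adj (spoke (i mod n))

  outer-adj : ∀ i → Adj G₂ (vertex V i) (vertex V (1 + i))
  outer-adj i = subst (λ j → Adj G₂ (vertex V i) (join n n (v j))) (mod-⊕ i 1) (edge⇒adj (outer (i mod n)))

  inner-adj : ∀ i → Adj G₂ (vertex U i) (vertex U (2 + i))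
  inner-adj i = subst (λ j → Adj G₂ (vertex U i) (join n n (u j))) (mod-⊕ i 2) (edge⇒adj (inner (i mod n)))

  vertex-periodic : ∀ t i → vertex t (n + i) ≡ vertex t i
  vertex-periodic t i = cong (λ j → join n n (side t j))
    (Fin.fromℕ<-cong _ _ (trans (cong (_% n) (+-comm n i)) ([m+n]%n≡m%n i n)) _ _)

  -- Inner edges cover the difference two at a time, and an outer edge corrects odd parity. Between
  -- two vertices of kind `V` the alternatives are to stay on the outer cycle or to take a spoke and
  -- continue as `walkUV`.
  walk : ∀ t s i δ → Walk G₂ (profile t s δ) (vertex t i) (vertex s (δ + i))
  walkUV : ∀ i δ → Walk G₂ (ramp 1 2 δ) (vertex U i) (vertex V (δ + i))
  walkUV i zero          = spoke-adj i ∷ []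
  walkUV i (suc zero)    = spoke-adj i ∷ (outer-adj i ∷ [])
  walkUV i (suc (suc δ)) = inner-adj i ∷
    subst (λ j → Walk G₂ (ramp 1 2 δ) (vertex U (2 + i)) (vertex V j)) (trans (+-suc δ (suc i)) (cong suc (+-suc δ i)))
      (walkUV (2 + i) δ)
  walk U V i δ = walkUV i δ
  walk U U i zero          = []
  walk U U i (suc zero)    = spoke-adj i ∷ (outer-adj i ∷ (sym- G₂ (spoke-adj (suc i)) ∷ []))
  walk U U i (suc (suc δ)) = walk U U i δ ∷ʳ inner-adj (δ + i)
  walk V U i zero          = sym- G₂ (spoke-adj i) ∷ []
  walk V U i (suc zero)    = outer-adj i ∷ (sym- G₂ (spoke-adj (suc i)) ∷ [])
  walk V U i (suc (suc δ)) = walk V U i δ ∷ʳ inner-adj (δ + i)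
  walk V V i δ with ⊓-sel δ (ramp 2 3 δ)
  ... | inj₁ eq rewrite eq = rim δ
    where
    rim : ∀ δ → Walk G₂ δ (vertex V i) (vertex V (δ + i))
    rim zero    = []
    rim (suc δ) = rim δ ∷ʳ outer-adj (δ + i)
  ... | inj₂ eq rewrite eq | ramp-suc 1 2 δ = sym- G₂ (spoke-adj i) ∷ walkUV i δ

  walk-cyclic : ∀ t s {i c} → i ≤ c → c ≤ n + i →
                Walk G₂ (cyclic n (profile t s) (c ∸ i)) (vertex t i) (vertex s c)
  walk-cyclic t s {i} {c} i≤c c≤n+i with ⊓-sel (profile t s (c ∸ i)) (profile t s (n ∸ (c ∸ i)))
  ... | inj₁ eq rewrite eq = subst (λ j → Walk G₂ (profile t s (c ∸ i)) (vertex t i) (vertex s j)) (m∸n+n≡m i≤c) (walk t s i (c ∸ i))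
  -- The other way round: from `c` onwards to `n + i`, which is the vertex with index `i` again, and
  -- then reversed.
  ... | inj₂ eq rewrite eq | profile-comm t s (n ∸ (c ∸ i)) = reverse
    (subst (Walk G₂ _ (vertex s c)) (trans (cong (vertex t) back) (vertex-periodic t i)) (walk s t c (n ∸ (c ∸ i))))
    where
    back : n ∸ (c ∸ i) + c ≡ n + i
    back = begin
      n ∸ (c ∸ i) + c               ≡⟨ cong (n ∸ (c ∸ i) +_) (m∸n+n≡m i≤c) ⟨
      n ∸ (c ∸ i) + (c ∸ i + i)     ≡⟨ +-assoc (n ∸ (c ∸ i)) (c ∸ i) i ⟨
      n ∸ (c ∸ i) + (c ∸ i) + i     ≡⟨ cong (_+ i) (m∸n+n≡m (m≤n+o⇒m∸n≤o c i (subst (c ≤_) (+-comm n i) c≤n+i))) ⟩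
      n + i                         ∎
      where open ≡-Reasoning

  walk-dist : ∀ t s {i c} → i < n → c < n → Walk G₂ (dist n (t , i) (s , c)) (vertex t i) (vertex s c)
  walk-dist t s {i} {c} i<n c<n with ≤-total i c
  ... | inj₁ i≤c rewrite m≤n⇒∣m-n∣≡n∸m i≤c = walk-cyclic t s i≤c (≤-trans (<⇒≤ c<n) (m≤m+n n i))
  ... | inj₂ c≤i rewrite m≤n⇒∣n-m∣≡n∸m c≤i | profile-comm t s (i ∸ c) | profile-comm t s (n ∸ (i ∸ c)) =
    reverse (walk-cyclic s t c≤i (≤-trans (<⇒≤ i<n) (m≤m+n n c)))

  edge-close : ∀ {a b} → PetersenEdge n 2 a b → ∀ {w} → proj₂ w < n → Close (dist n (label a) w) (dist n (label b) w)
  edge-close (spoke i) {s , c} c<n = close-⊓ (profile-UV-close s ∣ toℕ i - c ∣) (profile-UV-close s (n ∸ ∣ toℕ i - c ∣))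
  edge-close (outer i) {s , c} c<n =
    subst (λ j → Close (dist n (V , toℕ i) (s , c)) (cyclic n (profile V s) ∣ j - c ∣)) (sym (toℕ-⊕ i 1))
      (rotation-close (profile V s) (s≤s z≤n) (≤-trans (n≤1+n 2) 2<n) gap₁ (profile-V-close s) (Fin.toℕ<n i) c<n)
  edge-close (inner i) {s , c} c<n =
    subst (λ j → Close (dist n (U , toℕ i) (s , c)) (cyclic n (profile U s) ∣ j - c ∣)) (sym (toℕ-⊕ i 2))
      (rotation-close (profile U s) ≤-refl 2<n gap₂ (profile-U-close s) (Fin.toℕ<n i) c<n)

  adj-close : ∀ {x y} → Adj G₂ x y → ∀ {w} → proj₂ w < n → Close (dist n (coordinates {n} x) w) (dist n (coordinates {n} y) w)
  adj-close (inj₁ e) w<n = edge-close e w<n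
  adj-close (inj₂ e) w<n = close-sym (edge-close e w<n)

  dist-self : ∀ w → dist n w w ≡ 0
  dist-self (U , c) rewrite ∣n-n∣≡0 c = refl
  dist-self (V , c) rewrite ∣n-n∣≡0 c = refl

  -- As a function of its first argument, `dist` vanishes at the target and changes by at most 1
  -- along an edge. It therefore bounds walk lengths from below, and `walk-dist` shows that the
  -- bound is attained.
  dist≤ : ∀ {d x w} → Walk G₂ d x w → dist n (coordinates {n} x) (coordinates {n} w) ≤ d
  dist≤ {x = x} [] = ≤-reflexive (dist-self (coordinates {n} x))
  dist≤ {w = w} (e ∷ p) = ≤-trans (proj₁ (adj-close e (label< (splitAt n w)))) (s≤s (dist≤ p))

  toVertex : Kind × ℕ → Fin (n + n)
  toVertex (t , i) = vertex t i

  vertex-toℕ : ∀ t (i : Fin n) → vertex t (toℕ i) ≡ join n n (side t i)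
  vertex-toℕ t i = cong (λ i → join n n (side t i))
    (trans (Fin.fromℕ<-cong _ _ (m<n⇒m%n≡m (Fin.toℕ<n i)) _ (Fin.toℕ<n i)) (Fin.fromℕ<-toℕ i (Fin.toℕ<n i)))

  vertex-coordinates : ∀ x → toVertex (coordinates {n} x) ≡ x
  vertex-coordinates x = trans (vertex-label (splitAt n x)) (Fin.join-splitAt n n x)
    where
    vertex-label : ∀ a → toVertex (label a) ≡ join n n a
    vertex-label (u i) = vertex-toℕ U i
    vertex-label (v i) = vertex-toℕ V i

  distance-isDistance : ∀ x w → IsDistance G₂ x w (distance {n} x w)
  distance-isDistance x w = subst₂ (Walk G₂ (distance {n} x w)) (vertex-coordinates x) (vertex-coordinates w)
      (walk-dist (proj₁ (coordinates {n} x)) (proj₁ (coordinates {n} w)) (label< (splitAt n x)) (label< (splitAt n w)))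
    , λ d p → dist≤ p

  distance-resolves : ∀ {x y w} → distance {n} x w ≢ distance {n} y w → Resolves G₂ w x y
  distance-resolves {x} {y} {w} ne eq = ne
    (minimum-unique (Equivalence.to (eq _) (distance-isDistance x w)) (distance-isDistance y w))

-- Lower bound: coordinates given by two landmarks.

minimum-exists : {Q : ℕ → Set} → (∀ d → Dec (Q d)) → Q d → ∃ (IsMinimum Q)
minimum-exists {d = d} Q? q with Q? 0
... | yes q₀ = 0 , q₀ , λ _ _ → z≤n
minimum-exists {d = zero}  Q? q | no ¬q₀ = ⊥-elim (¬q₀ q)
minimum-exists {d = suc d} Q? q | no ¬q₀ =
  let m , qm , m≤ = minimum-exists (λ d → Q? (suc d)) q
  in suc m , qm , λ { zero q₀ → ⊥-elim (¬q₀ q₀) ; (suc j) qj → s≤s (m≤ j qj) }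

walk? : (G : Graph N) → ∀ d x y → Dec (Walk G d x y)
walk? G zero x y = map′ (λ { refl → [] }) (λ { [] → refl }) (x Fin.≟ y)
walk? G (suc d) x y = map′ (λ { (z , e , p) → e ∷ p }) (λ { (e ∷ p) → _ , e , p })
  (Fin.any? (λ z → adj? G x z ×-dec walk? G d z y))

map-walk : {G H : Graph N} → G SpanningSubgraphOf H → ∀ {x y} → Walk G d x y → Walk H d x y
map-walk f []      = []
map-walk f (e ∷ p) = f e ∷ map-walk f p

-- Smaller sets are padded so that there are always two landmarks: `x` fills in for an empty `W`,
-- and the element of a singleton is repeated.
pair-covering : (x : Fin N) (W : Subset N) → ∣ W ∣ < 3 → ∃₂ λ a b → ∀ {w} → w ∈ W → w ≡ a ⊎ w ≡ b
pair-covering x W W<3 with nonempty? W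
... | no empty = x , x , λ w∈W → ⊥-elim (empty (_ , w∈W))
... | yes (a , a∈W) with nonempty? (W without a)
...   | no empty = a , a , λ {w} w∈W → inj₁ (only w∈W)
  where
  only : ∀ {w} → w ∈ W → w ≡ a
  only {w} w∈W with w Fin.≟ a
  ... | yes eq = eq
  ... | no w≢a = ⊥-elim (empty (w , x∈p∧x≢y⇒x∈p-y w∈W w≢a))
...   | yes (b , b∈W-a) = a , b , either
  where
  either : ∀ {w} → w ∈ W → w ≡ a ⊎ w ≡ b
  either {w} w∈W with w Fin.≟ a | w Fin.≟ b
  ... | yes eq | _ = inj₁ eq
  ... | no _ | yes eq = inj₂ eq
  -- Either nothing is left after removing `a` and `b`, although `w` is, or `W` has at least three
  -- elements.
  ... | no w≢a | no w≢b with ∣ W without a without b ∣ in eq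
  ...   | zero = ⊥-elim (n≮0 (subst (∣ W without a without b without w ∣ <_) eq
            (x∈p⇒∣p-x∣<∣p∣ (x∈p∧x≢y⇒x∈p-y (x∈p∧x≢y⇒x∈p-y w∈W w≢a) w≢b))))
  ...   | suc m = ⊥-elim (<⇒≱ W<3 (≤-trans (s≤s (≤-trans (s≤s (≤-trans (s≤s z≤n) (≤-reflexive (sym eq))))
            (x∈p⇒∣p-x∣<∣p∣ b∈W-a))) (x∈p⇒∣p-x∣<∣p∣ a∈W)))

-- That `a` and `b` resolve `H`, restated with distances as numbers: x ↦ (p x, q x) is injective.
record Coordinates (H : Graph N) (a b : Fin N) : Set where
  field
    p q      : Fin N → ℕ
    p-isDist : ∀ x → IsDistance H x a (p x)
    q-isDist : ∀ x → IsDistance H x b (q x)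
    pq-inj   : ∀ {x y} → p x ≡ p y → q x ≡ q y → x ≡ y

swap-coordinates : {H : Graph N} {a b : Fin N} → Coordinates H a b → Coordinates H b a
swap-coordinates C = record
  { p = q ; q = p ; p-isDist = q-isDist ; q-isDist = p-isDist ; pq-inj = flip pq-inj }
  where open Coordinates C

module Sphere {H : Graph N} {a b : Fin N} (C : Coordinates H a b) where
  open Coordinates C

  p≤ : ∀ {d x} → Walk H d x a → p x ≤ d
  p≤ {d} {x} w = proj₂ (p-isDist x) d w

  p≡0 : ∀ {x} → p x ≡ 0 → x ≡ a
  p≡0 {x} eq with [] ← subst (λ d → Walk H d x a) eq (proj₁ (p-isDist x)) = refl

  p≡1 : ∀ {x} → p x ≡ 1 → Adj H x a
  p≡1 {x} eq with e ∷ [] ← subst (λ d → Walk H d x a) eq (proj₁ (p-isDist x)) = e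

  q-adj : ∀ {x y} → Adj H x y → q x ≤ suc (q y)
  q-adj {x} e = proj₂ (q-isDist x) _ (e ∷ proj₁ (q-isDist _))

  adj⇒p≡1 : ∀ {x} → Adj H x a → p x ≡ 1
  adj⇒p≡1 {x} e with p x in eq | p≤ (e ∷ [])
  ... | zero        | _       = ⊥-elim (irrefl H refl (subst (λ x → Adj H x a) (p≡0 eq) e))
  ... | suc zero    | _       = refl
  ... | suc (suc _) | s≤s ()

  -- This is |q x - q a| ≤ r, free of truncated subtraction.
  Within : ℕ → Fin N → Set
  Within r x = q x ≤ r + q a × q a ≤ r + q x

  within-adj : ∀ {r x y} → Adj H x y → Within r y → Within (suc r) x
  within-adj {r} {x} {y} e (h , h′) = ≤-trans (q-adj e) (s≤s h) ,
    ≤-trans h′ (≤-trans (+-monoʳ-≤ r (q-adj (sym- H e))) (≤-reflexive (+-suc r (q x))))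

  within-refl : Within 0 a
  within-refl = ≤-refl , ≤-refl

  -- Vertices with the same `p` have different `q`, and only 2r + 1 values of `q` are within `r` of
  -- `q a`; the pigeonhole principle does the rest.
  crowded : ∀ {m l} r (f : Fin m → Fin N) → Injective _≡_ _≡_ f → (∀ k → p (f k) ≡ l) →
            (∀ k → Within r (f k)) → suc (r + r) < m → ⊥
  crowded {m} r f f-inj f-p f-q r<m = Fin.<⇒≢ i<j (f-inj (pq-inj (trans (f-p i) (sym (f-p j)))
    (+-cancelˡ-≡ r _ _ (∸-cancelʳ-≡ (proj₂ (f-q i)) (proj₂ (f-q j)) same))))
    where
    -- Adding `r` first keeps the truncated subtraction exact; the slots are 0, ..., 2r.
    slot : Fin m → ℕ
    slot k = r + q (f k) ∸ q a

    slot< : ∀ k → slot k < suc (r + r)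
    slot< k = s≤s (m≤n+o⇒m∸n≤o (r + q (f k)) (q a) (begin
      r + q (f k)     ≤⟨ +-monoʳ-≤ r (proj₁ (f-q k)) ⟩
      r + (r + q a)   ≡⟨ +-assoc r r (q a) ⟨
      r + r + q a     ≡⟨ +-comm (r + r) (q a) ⟩
      q a + (r + r)   ∎))
      where open ≤-Reasoning

    collision : ∃₂ λ i j → i Fin.< j × fromℕ< (slot< i) ≡ fromℕ< (slot< j)
    collision = Fin.pigeonhole r<m (λ k → fromℕ< (slot< k))

    i j : Fin m
    i = proj₁ collision
    j = proj₁ (proj₂ collision)

    i<j : i Fin.< j
    i<j = proj₁ (proj₂ (proj₂ collision))

    same : slot i ≡ slot j
    same = Fin.fromℕ<-injective _ _ (slot< i) (slot< j) (proj₂ (proj₂ (proj₂ collision)))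

  module _ (nb : Fin 3 → Fin N) (nb-inj : Injective _≡_ _≡_ nb) (nb-adj : ∀ k → Adj H (nb k) a) where

    -- A fourth neighbour would make four vertices at distance 1 compete for the three slots of
    -- radius 1.
    no-further-neighbour : ∀ {x} → p x ≡ 1 → ∃[ k ] x ≡ nb k
    no-further-neighbour {x} px≡1 with Fin.any? (λ k → x Fin.≟ nb k)
    ... | yes found = found
    ... | no  fresh = ⊥-elim (crowded 1 (x Functional.∷ nb) inj
            (λ { zero → px≡1 ; (suc k) → adj⇒p≡1 (nb-adj k) })
            (λ { zero → within-adj (p≡1 px≡1) within-refl ; (suc k) → within-adj (nb-adj k) within-refl }) ≤-refl)
      where
      inj : Injective _≡_ _≡_ (x Functional.∷ nb)
      inj {zero}  {zero}  eq = refl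
      inj {zero}  {suc j} eq = ⊥-elim (fresh (j , eq))
      inj {suc i} {zero}  eq = ⊥-elim (fresh (i , sym eq))
      inj {suc i} {suc j} eq = cong suc (nb-inj eq)

    -- The walk gives distance at most 2; distance 1 is excluded because `nb` already exhausts the
    -- neighbours of `a` in `H`.
    second-neighbour : ∀ {x y} → Adj H x y → Adj H y a → x ≢ a → (∀ k → x ≢ nb k) → p x ≡ 2
    second-neighbour {x} e e′ x≢a x≢nb with p x in eq | p≤ (e ∷ (e′ ∷ []))
    ... | zero              | _             = ⊥-elim (x≢a (p≡0 eq))
    ... | suc zero          | _             = ⊥-elim (let j , x≡nb = no-further-neighbour eq in x≢nb j x≡nb)
    ... | suc (suc zero)    | _             = refl
    ... | suc (suc (suc _)) | s≤s (s≤s ())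

    -- Radius 2 offers only five slots.
    no-six-second-neighbours : (f : Fin 6 → Fin N) → Injective _≡_ _≡_ f → (∀ i → f i ≢ a) →
      (∀ i k → f i ≢ nb k) → (∀ i → ∃[ k ] Adj H (f i) (nb k)) → ⊥
    no-six-second-neighbours f f-inj f≢a f≢nb f-adj = crowded 2 f f-inj
      (λ i → second-neighbour (proj₂ (f-adj i)) (nb-adj _) (f≢a i) (f≢nb i))
      (λ i → within-adj (proj₂ (f-adj i)) (within-adj (nb-adj _) within-refl)) ≤-refl

-- Lower bound: balls of radius 2 in P(n,2).

_≟ᴷ_ : DecidableEquality Kind
U ≟ᴷ U = yes refl
U ≟ᴷ V = no λ ()
V ≟ᴷ U = no λ ()
V ≟ᴷ V = yes refl

-- The balls of radius 2 about a vertex of kind U and one of kind V, each listed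
-- as the centre, its 3 neighbours and its 6 second neighbours.  Indices are
-- offset so that they are natural numbers.
ball-U ball-V : Fin 10 → Kind × ℕ
ball-U = lookup (
  (U , 4) ∷ (V , 4) ∷ (U , 6) ∷ (U , 2) ∷
  (V , 3) ∷ (V , 5) ∷ (U , 8) ∷ (V , 6) ∷ (U , 0) ∷ (V , 2) ∷ [])
ball-V = lookup (
  (V , 2) ∷ (U , 2) ∷ (V , 3) ∷ (V , 1) ∷
  (U , 0) ∷ (U , 4) ∷ (U , 3) ∷ (V , 4) ∷ (U , 1) ∷ (V , 0) ∷ [])

near# : Fin 3 → Fin 10
near# i = suc (i Fin.↑ˡ 6)

far# : Fin 6 → Fin 10
far# i = 4 Fin.↑ʳ i

-- The condition under which the pattern of offsets `B` embeds in P(n,2) without two of its vertices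
-- merging.
DistinctModulo : (n : ℕ) .{{_ : NonZero n}} → (Fin k → Kind × ℕ) → Set
DistinctModulo n B = ∀ i j → residue (B i) ≡ residue (B j) → i ≡ j
  where
  residue : Kind × ℕ → Kind × ℕ
  residue (t , o) = t , o % n

distinctModulo? : (n : ℕ) .{{_ : NonZero n}} (B : Fin k → Kind × ℕ) → Dec (DistinctModulo n B)
distinctModulo? n B = Fin.all? λ i → Fin.all? λ j → ≡-dec _≟ᴷ_ ℕ._≟_ _ _ →-dec (i Fin.≟ j)

-- Offsets below `m` are their own residues modulo `m` and modulo `n`, so one computed check at `m`
-- covers every larger `n`.
distinctModulo-larger : ∀ m n .{{_ : NonZero m}} .{{_ : NonZero n}} (B : Fin k → Kind × ℕ) → m ≤ n →
                        (∀ i → proj₂ (B i) < m) → DistinctModulo m B → DistinctModulo n B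
distinctModulo-larger m n B m≤n B<m distinct i j eq = distinct i j (cong₂ _,_ (cong proj₁ eq)
  (trans (reduce i) (trans (cong proj₂ eq) (sym (reduce j)))))
  where
  reduce : ∀ i → proj₂ (B i) % m ≡ proj₂ (B i) % n
  reduce i = trans (m<n⇒m%n≡m (B<m i)) (sym (m<n⇒m%n≡m (≤-trans (B<m i) m≤n)))

offsets< : (m : ℕ) (B : Fin k → Kind × ℕ) → Dec (∀ i → proj₂ (B i) < m)
offsets< m B = Fin.all? λ i → proj₂ (B i) <? m

module _ (2<n : 2 < n) where
  private instance
    n≢0 : NonZero n
    n≢0 = >-nonZero (≤-trans z<s 2<n)

  vertex-injective : ∀ t s {i j} → vertex 2<n t i ≡ vertex 2<n s j → t ≡ s × i % n ≡ j % n
  vertex-injective t s {i} {j} eq = sides t s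
    (trans (sym (Fin.splitAt-join n n _)) (trans (cong (splitAt n) eq) (Fin.splitAt-join n n _)))
    where
    residues : i mod n ≡ j mod n → i % n ≡ j % n
    residues h = trans (sym (Fin.toℕ-fromℕ< _)) (trans (cong toℕ h) (Fin.toℕ-fromℕ< _))

    sides : ∀ t s → side t (i mod n) ≡ side s (j mod n) → t ≡ s × i % n ≡ j % n
    sides U U h = refl , residues (inj₁-injective h)
    sides V V h = refl , residues (inj₂-injective h)

  -- Adding `b * pred n` undoes the addition of `b` modulo `n`, since the two together make `b * n`.
  +-cancel-% : ∀ x y b → (x + b) % n ≡ (y + b) % n → x % n ≡ y % n
  +-cancel-% x y b eq = begin
    x % n                                   ≡⟨ complete x ⟨
    (x + b + b * pred n) % n                ≡⟨ %-distribˡ-+ (x + b) (b * pred n) n ⟩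
    ((x + b) % n + b * pred n % n) % n      ≡⟨ cong (λ z → (z + b * pred n % n) % n) eq ⟩
    ((y + b) % n + b * pred n % n) % n      ≡⟨ %-distribˡ-+ (y + b) (b * pred n) n ⟨
    (y + b + b * pred n) % n                ≡⟨ complete y ⟩
    y % n                                   ∎
    where
    open ≡-Reasoning
    complete : ∀ x → (x + b + b * pred n) % n ≡ x % n
    complete x = trans (cong (_% n) (trans (+-assoc x b _)
      (cong (x +_) (trans (sym (*-suc b (pred n))) (cong (b *_) (suc-pred n)))))) ([m+kn]%n≡m%n x b n)

  place : (Fin k → Kind × ℕ) → ℕ → Fin k → Fin (n + n)
  place B b i = vertex 2<n (proj₁ (B i)) (proj₂ (B i) + b)

  place-injective : (B : Fin k → Kind × ℕ) → DistinctModulo n B → ∀ b → Injective _≡_ _≡_ (place B b)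
  place-injective B distinct b {i} {j} eq =
    let t≡s , o≡o′ = vertex-injective _ _ eq
    in distinct i j (cong₂ _,_ t≡s (+-cancel-% (proj₂ (B i)) (proj₂ (B j)) b o≡o′))

  private
    G₂ : Graph (n + n)
    G₂ = P n 2 2<n

  ball-U-near : ∀ b (i : Fin 3) → Adj G₂ (place ball-U b (near# i)) (place ball-U b zero)
  ball-U-near b zero             = sym- G₂ (spoke-adj 2<n (4 + b))
  ball-U-near b (suc zero)       = sym- G₂ (inner-adj 2<n (4 + b))
  ball-U-near b (suc (suc zero)) = inner-adj 2<n (2 + b)

  ball-U-far : ∀ b (i : Fin 6) → ∃[ k ] Adj G₂ (place ball-U b (far# i)) (place ball-U b (near# k))
  ball-U-far b zero                               = zero {2} , outer-adj 2<n (3 + b)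
  ball-U-far b (suc zero)                         = zero , sym- G₂ (outer-adj 2<n (4 + b))
  ball-U-far b (suc (suc zero))                   = suc zero , sym- G₂ (inner-adj 2<n (6 + b))
  ball-U-far b (suc (suc (suc zero)))             = suc zero , sym- G₂ (spoke-adj 2<n (6 + b))
  ball-U-far b (suc (suc (suc (suc zero))))       = suc (suc zero) , inner-adj 2<n b
  ball-U-far b (suc (suc (suc (suc (suc zero))))) = suc (suc zero) , sym- G₂ (spoke-adj 2<n (2 + b))

  ball-V-near : ∀ b (i : Fin 3) → Adj G₂ (place ball-V b (near# i)) (place ball-V b zero)
  ball-V-near b zero             = spoke-adj 2<n (2 + b)
  ball-V-near b (suc zero)       = sym- G₂ (outer-adj 2<n (2 + b))
  ball-V-near b (suc (suc zero)) = outer-adj 2<n (1 + b)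

  ball-V-far : ∀ b (i : Fin 6) → ∃[ k ] Adj G₂ (place ball-V b (far# i)) (place ball-V b (near# k))
  ball-V-far b zero                               = zero {2} , inner-adj 2<n b
  ball-V-far b (suc zero)                         = zero , sym- G₂ (inner-adj 2<n (2 + b))
  ball-V-far b (suc (suc zero))                   = suc zero , spoke-adj 2<n (3 + b)
  ball-V-far b (suc (suc (suc zero)))             = suc zero , sym- G₂ (outer-adj 2<n (3 + b))
  ball-V-far b (suc (suc (suc (suc zero))))       = suc (suc zero) , spoke-adj 2<n (1 + b)
  ball-V-far b (suc (suc (suc (suc (suc zero))))) = suc (suc zero) , outer-adj 2<n b

  module _ {H : Graph (n + n)} (G⊆H : G₂ SpanningSubgraphOf H) where

    no-ball : (f : Fin 10 → Fin (n + n)) → Injective _≡_ _≡_ f →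
              (∀ (i : Fin 3) → Adj G₂ (f (near# i)) (f zero)) →
              (∀ (i : Fin 6) → ∃[ k ] Adj G₂ (f (far# i)) (f (near# k))) →
              ∀ {b} → Coordinates H (f zero) b → ⊥
    no-ball f f-inj near far C = no-six-second-neighbours
      (λ i → f (near# i)) (λ eq → Fin.↑ˡ-injective 6 _ _ (Fin.suc-injective (f-inj eq))) (λ i → G⊆H (near i))
      (λ i → f (far# i)) (λ eq → Fin.↑ʳ-injective 4 _ _ (f-inj eq))
      (λ i eq → case (f-inj eq) of λ ())
      (λ i k eq → separate i k (f-inj eq))
      (λ i → let k , e = far i in k , G⊆H e)
      where
      open Sphere C
      separate : ∀ (i : Fin 6) (k : Fin 3) → far# i ≢ near# k
      separate i zero             ()
      separate i (suc zero)       ()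
      separate i (suc (suc zero)) ()

    -- Extra edges can only shorten distances, but `a` has no neighbour in `H` beyond its three in
    -- P(n,2), so a vertex at distance 2 cannot come closer.
    distance-exact : ∀ {a b} (C : Coordinates H a b) (nb : Fin 3 → Fin (n + n)) → Injective _≡_ _≡_ nb →
                     (∀ k → Adj G₂ (nb k) a) → ∀ x → distance {n} x a ≤ 2 → Coordinates.p C x ≡ distance {n} x a
    distance-exact {a} C nb nb-inj nb-adj x d≤2 = go (distance {n} x a) refl (proj₁ (distance-isDistance 2<n x a)) d≤2
      where
      open Coordinates C
      open Sphere C
      go : ∀ d → distance {n} x a ≡ d → Walk G₂ d x a → d ≤ 2 → p x ≡ d
      go 0 eq []             d≤2 = n≤0⇒n≡0 (p≤ [])
      go 1 eq (e ∷ [])       d≤2 = adj⇒p≡1 (G⊆H e)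
      go 2 eq (e ∷ (f ∷ [])) d≤2 = second-neighbour nb nb-inj (λ k → G⊆H (nb-adj k)) (G⊆H e) (G⊆H f)
        (λ { refl → <⇒≱ (s≤s z≤n) (subst (_≤ 0) eq (dist≤ 2<n [])) })
        (λ { k refl → <⇒≱ (s≤s (s≤s z≤n)) (subst (_≤ 1) eq (dist≤ 2<n (nb-adj k ∷ []))) })
      go (suc (suc (suc _))) eq w (s≤s (s≤s ()))

  -- The centre of a ball sits at offset `m`, which is 2 for `ball-V` and 4 for `ball-U`. The base i
  -- - m is represented by the natural number `n ∸ m + i`.
  recentre : ∀ m → m ≤ n → ∀ t i → vertex 2<n t i ≡ vertex 2<n t (m + (n ∸ m + i))
  recentre m m≤n t i = begin
    vertex 2<n t i                 ≡⟨ vertex-periodic 2<n t i ⟨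
    vertex 2<n t (n + i)           ≡⟨ cong (λ z → vertex 2<n t (z + i)) (m+[n∸m]≡n m≤n) ⟨
    vertex 2<n t (m + (n ∸ m) + i) ≡⟨ cong (vertex 2<n t) (+-assoc m (n ∸ m) i) ⟩
    vertex 2<n t (m + (n ∸ m + i)) ∎
    where open ≡-Reasoning

ball-V-distinct : .{{_ : NonZero n}} → 5 ≤ n → DistinctModulo n ball-V
ball-V-distinct 5≤n = distinctModulo-larger 5 _ ball-V 5≤n (from-yes (offsets< 5 ball-V)) (from-yes (distinctModulo? 5 ball-V))

-- If a and b resolve H and distances up to 2 from them are the same in H as in
-- P(n,2), then there are no such x and y.
Clash : (n : ℕ) → Fin (n + n) → Fin (n + n) → Fin (n + n) → Fin (n + n) → Set
Clash n a b x y = x ≢ y × (distance {n} x a ≤ 2 × distance {n} x a ≡ distance {n} y a)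
                        × (distance {n} x b ≤ 2 × distance {n} x b ≡ distance {n} y b)

clash? : ∀ n a b x y → Dec (Clash n a b x y)
clash? n a b x y = ¬? (x Fin.≟ y) ×-dec ((distance {n} x a ≤? 2) ×-dec (distance {n} x a ℕ.≟ distance {n} y a))
                                  ×-dec ((distance {n} x b ≤? 2) ×-dec (distance {n} x b ℕ.≟ distance {n} y b))

clashes? : ∀ n → Dec (∀ (i j : Fin n) → ∃₂ (Clash n (join n n (u i)) (join n n (u j))))
clashes? n = Fin.all? λ i → Fin.all? λ j → Fin.any? λ x → Fin.any? λ y → clash? n _ _ x y

clashes-6 : ∀ (i j : Fin 6) → ∃₂ (Clash 6 (join 6 6 (u i)) (join 6 6 (u j)))
clashes-6 = from-yes (clashes? 6)

clashes-8 : ∀ (i j : Fin 8) → ∃₂ (Clash 8 (join 8 8 (u i)) (join 8 8 (u j)))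
clashes-8 = from-yes (clashes? 8)

-- Lower bound: no two landmarks resolve a supergraph.

NoCoordinates : (n : ℕ) → 2 < n → Set₁
NoCoordinates n 2<n = {H : Graph (n + n)} → P n 2 2<n SpanningSubgraphOf H → ∀ {a b} → ¬ Coordinates H a b

module _ (5≤n : 5 ≤ n) (2<n : 2 < n) where
  private instance
    n≢0 : NonZero n
    n≢0 = >-nonZero (≤-trans z<s 2<n)

  module _ {H : Graph (n + n)} (G⊆H : P n 2 2<n SpanningSubgraphOf H) where

    V-not-landmark : ∀ {i b} → ¬ Coordinates H (vertex 2<n V i) b
    V-not-landmark {i} {b} C = no-ball 2<n G⊆H (place 2<n ball-V (n ∸ 2 + i))
      (place-injective 2<n ball-V (ball-V-distinct 5≤n) (n ∸ 2 + i)) (ball-V-near 2<n _) (ball-V-far 2<n _)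
      (subst (λ a → Coordinates H a b) (recentre 2<n 2 (<⇒≤ 2<n) V i) C)

    U-not-landmark : DistinctModulo n ball-U → ∀ {i b} → ¬ Coordinates H (vertex 2<n U i) b
    U-not-landmark distinct {i} {b} C = no-ball 2<n G⊆H (place 2<n ball-U (n ∸ 4 + i))
      (place-injective 2<n ball-U distinct (n ∸ 4 + i)) (ball-U-near 2<n _) (ball-U-far 2<n _)
      (subst (λ a → Coordinates H a b) (recentre 2<n 4 (≤-trans (n≤1+n 4) 5≤n) U i) C)

    U-distance-exact : DistinctModulo n (ball-U ∘ near#) → ∀ {i b} (C : Coordinates H (vertex 2<n U i) b) →
                       ∀ x → distance {n} x (vertex 2<n U i) ≤ 2 → Coordinates.p C x ≡ distance {n} x (vertex 2<n U i)
    U-distance-exact distinct {i} C = distance-exact 2<n G⊆H C (place 2<n (ball-U ∘ near#) (n ∸ 4 + i))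
      (place-injective 2<n (ball-U ∘ near#) distinct (n ∸ 4 + i))
      (λ k → subst (Adj (P n 2 2<n) _) (sym (recentre 2<n 4 (≤-trans (n≤1+n 4) 5≤n) U i)) (ball-U-near 2<n (n ∸ 4 + i) k))

  no-coordinates : DistinctModulo n ball-U → NoCoordinates n 2<n
  no-coordinates distinct G⊆H {a} C with coordinates {n} a | vertex-coordinates 2<n a
  ... | U , i | refl = U-not-landmark G⊆H distinct C
  ... | V , i | refl = V-not-landmark G⊆H C

  -- This serves n = 6 and n = 8. A landmark of kind `V` is excluded as before, whichever of the two
  -- it is. If both are of kind `U`, distances up to 2 are exact, so a clashing pair has equal
  -- coordinates in `H`.
  no-coordinates-clash : DistinctModulo n (ball-U ∘ near#) →
    (∀ (i j : Fin n) → ∃₂ (Clash n (join n n (u i)) (join n n (u j)))) → NoCoordinates n 2<n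
  no-coordinates-clash distinct clash {H} G⊆H {a} {b} C
    with splitAt n a | Fin.join-splitAt n n a | splitAt n b | Fin.join-splitAt n n b
  ... | v i | refl | _   | _    =
    V-not-landmark G⊆H (subst (λ a → Coordinates H a b) (sym (vertex-toℕ 2<n V i)) C)
  ... | u i | refl | v j | refl =
    V-not-landmark G⊆H (subst (λ b → Coordinates H b _) (sym (vertex-toℕ 2<n V j)) (swap-coordinates C))
  ... | u i | refl | u j | refl = separate (clash i j)
    where
    exact : ∀ {i b} (C : Coordinates H (join n n (u i)) b) →
            ∀ x → distance {n} x (join n n (u i)) ≤ 2 → Coordinates.p C x ≡ distance {n} x (join n n (u i))
    exact {i} {b} = subst
      (λ a → (C : Coordinates H a b) → ∀ x → distance {n} x a ≤ 2 → Coordinates.p C x ≡ distance {n} x a)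
      (vertex-toℕ 2<n U i) (U-distance-exact G⊆H distinct)

    agree : ∀ {i b} (C : Coordinates H (join n n (u i)) b) {x y} → let δ = λ x → distance {n} x (join n n (u i)) in
            δ x ≤ 2 → δ x ≡ δ y → Coordinates.p C x ≡ Coordinates.p C y
    agree C {x} {y} δ≤2 eq = trans (exact C x δ≤2) (trans eq (sym (exact C y (subst (_≤ 2) eq δ≤2))))

    separate : ¬ ∃₂ (Clash n (join n n (u i)) (join n n (u j)))
    separate (x , y , x≢y , (a≤2 , a≡) , (b≤2 , b≡)) =
      x≢y (Coordinates.pq-inj C (agree C a≤2 a≡) (agree (swap-coordinates C) b≤2 b≡))

ball-U-distinct-≥9 : .{{_ : NonZero n}} → 9 ≤ n → DistinctModulo n ball-U
ball-U-distinct-≥9 9≤n = distinctModulo-larger 9 _ ball-U 9≤n (from-yes (offsets< 9 ball-U)) (from-yes (distinctModulo? 9 ball-U))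

-- For n ≥ 5 the ten vertices of `ball-U` are distinct unless n = 6, where the inner offsets 0 and 6
-- merge, or n = 8, where 0 and 8 do: the inner cycles are then triangles and 4-cycles.
unresolvable : (5≤n : 5 ≤ n) (2<n : 2 < n) → NoCoordinates n 2<n
unresolvable {5} 5≤n 2<n = no-coordinates 5≤n 2<n (from-yes (distinctModulo? 5 ball-U))
unresolvable {6} 5≤n 2<n = no-coordinates-clash 5≤n 2<n (from-yes (distinctModulo? 6 (ball-U ∘ near#))) clashes-6
unresolvable {7} 5≤n 2<n = no-coordinates 5≤n 2<n (from-yes (distinctModulo? 7 ball-U))
unresolvable {8} 5≤n 2<n = no-coordinates-clash 5≤n 2<n (from-yes (distinctModulo? 8 (ball-U ∘ near#))) clashes-8
unresolvable {suc (suc (suc (suc (suc (suc (suc (suc (suc m))))))))} 5≤n 2<n =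
  no-coordinates 5≤n 2<n (ball-U-distinct-≥9 (m≤m+n 9 m))
unresolvable {1} (s≤s ()) 2<n
unresolvable {2} (s≤s (s≤s ())) 2<n
unresolvable {3} (s≤s (s≤s (s≤s ()))) 2<n
unresolvable {4} (s≤s (s≤s (s≤s (s≤s ())))) 2<n

module _ (2<n : 2 < n) {H : Graph (n + n)} (G⊆H : P n 2 2<n SpanningSubgraphOf H) where

  -- A walk in P(n,2) bounds the distance in `H`, and whether `H` has a walk of a given length is
  -- decidable, so the least length is found by search.
  distance-exists : ∀ x w → ∃ (IsDistance H x w)
  distance-exists x w = minimum-exists (λ d → walk? H d x w)
    (map-walk {G = P n 2 2<n} {H} G⊆H (proj₁ (distance-isDistance 2<n x w)))

  equal-distances : ∀ {x y w} → proj₁ (distance-exists x w) ≡ proj₁ (distance-exists y w) → EqualDistances H x w y w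
  equal-distances {x} {y} {w} eq d = mk⇔ (transfer x y eq) (transfer y x (sym eq))
    where
    transfer : ∀ x y → proj₁ (distance-exists x w) ≡ proj₁ (distance-exists y w) → IsDistance H x w d → IsDistance H y w d
    transfer x y eq h = subst (IsDistance H y w)
      (trans (sym eq) (minimum-unique (proj₂ (distance-exists x w)) h)) (proj₂ (distance-exists y w))

  resolved⇒coordinates : ∀ {a b} → (∀ x y → x ≢ y → ∃[ w ] (w ≡ a ⊎ w ≡ b) × Resolves H w x y) → Coordinates H a b
  resolved⇒coordinates {a} {b} resolved = record
    { p = λ x → proj₁ (distance-exists x a)
    ; q = λ x → proj₁ (distance-exists x b)
    ; p-isDist = λ x → proj₂ (distance-exists x a)
    ; q-isDist = λ x → proj₂ (distance-exists x b)
    ; pq-inj = inj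
    }
    where
    inj : ∀ {x y} → proj₁ (distance-exists x a) ≡ proj₁ (distance-exists y a) →
          proj₁ (distance-exists x b) ≡ proj₁ (distance-exists y b) → x ≡ y
    inj {x} {y} pe qe with x Fin.≟ y
    ... | yes x≡y = x≡y
    ... | no  x≢y with resolved x y x≢y
    ...   | _ , inj₁ refl , r = ⊥-elim (r (equal-distances pe))
    ...   | _ , inj₂ refl , r = ⊥-elim (r (equal-distances qe))

  resolving-set-≥3 : 5 ≤ n → ∀ W → IsResolvingSet H W → 3 ≤ ∣ W ∣
  resolving-set-≥3 5≤n W resolving with <-≤-connex ∣ W ∣ 3
  ... | inj₂ 3≤W = 3≤W
  ... | inj₁ W<3 = let a , b , covers = pair-covering (vertex 2<n U 0) W W<3 in
    ⊥-elim (unresolvable 5≤n 2<n G⊆H {a} {b} (resolved⇒coordinates λ x y x≢y →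
      let w , w∈W , r = resolving x y x≢y in w , covers w∈W , r))

-- Upper bound for n ≥ 8: three landmarks by linear arithmetic.

module TripleInjectivity where

  open LinearArithmetic
  open import Data.Integer as ℤ using (ℤ; +_; -[1+_]; 0ℤ; +≤+)
  import Data.Integer.Properties as ℤ
  import Data.Integer.Tactic.RingSolver as ℤ-Solver
  open import Data.List using (List; []; _∷_; _++_; map)
  open import Data.List.Relation.Unary.All as All using (All; []; _∷_)
  import Data.List.Relation.Unary.All.Properties as All
  open import Data.List.Relation.Unary.Any as Any using (Any; here; there)
  import Data.List.Relation.Unary.Any.Properties as Any
  open import Data.Nat.Tactic.RingSolver using (solve-∀)

  bit : Bool → ℕ
  bit b = if b then 1 else 0

  parity-split : ∀ m → ∃₂ λ h b → m ≡ h + h + bit b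
  parity-split zero          = 0 , false , refl
  parity-split (suc zero)    = 0 , true , refl
  parity-split (suc (suc m)) with parity-split m
  ... | h , b , eq = suc h , b , trans (cong (λ m → suc (suc m)) eq) (shift h (bit b))
    where
    shift : ∀ h b → 2 + (h + h + b) ≡ suc h + suc h + b
    shift = solve-∀

  -- (p , b) stands for the number 2 p + b.
  Halved : ℕ → Set
  Halved n = Lin n × Bool

  value : Halved n → Lin n
  value (p , b) = p ⊞ p ⊞ con (+ bit b)

  -- Binary subtraction of the last digit: `b xor c` is the new bit and `not b ∧ c` the borrow.
  _−ʰ_ : Halved n → Halved n → Halved n
  (p , b) −ʰ (q , c) = p ⊟ q ⊟ con (+ bit (not b ∧ c)) , b xor c

  -- Once the parity bit is known, `ramp` is linear in the half.
  rampʰ : ℕ → ℕ → Halved n → Lin n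
  rampʰ p q (h , b) = h ⊞ con (+ (if b then q else p))

  -- The linear forms whose minimum is `profile`.
  profileʰ : Kind → Kind → Halved n → List (Lin n)
  profileʰ U U δ = rampʰ 0 3 δ ∷ []
  profileʰ U V δ = rampʰ 1 2 δ ∷ []
  profileʰ V U δ = rampʰ 1 2 δ ∷ []
  profileʰ V V δ = value δ ∷ rampʰ 2 3 δ ∷ []

  -- f is the least of Xs: one alternative for each X at which the minimum may be
  -- attained, all of them subject to side ≥ 0.
  minimumClause : Lin n → Lin n → List (Lin n) → Clause n
  minimumClause f side Xs = map (λ X → (f ⊟ X ∷ []) & (side ∷ map (_⊟ f) Xs)) Xs

  -- Since the bit is 0 or 1, δ ≥ 0 holds exactly when its half is non-negative; hence the side
  -- condition `proj₁ δ`.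
  cyclicClause : Halved n → Lin n → Kind → Kind → Halved n → Clause n
  cyclicClause N f t s δ = minimumClause f (proj₁ δ) (profileʰ t s δ ++ profileʰ t s (N −ʰ δ))

  -- The two groups of alternatives belong to the two signs of i − c.
  distClause : Halved n → Lin n → Kind × Halved n → Kind × Halved n → Clause n
  distClause N f (t , i) (s , c) = cyclicClause N f t s (i −ʰ c) ++ cyclicClause N f t s (c −ʰ i)

  module _ (ρ : Vec ℤ n) where

    Denotes : Halved n → ℕ → Set
    Denotes (p , b) m = ⟦ p ⟧ ρ ℤ.+ ⟦ p ⟧ ρ ℤ.+ + bit b ≡ + m

    -- A negative half would make twice the half plus a bit negative.
    half : ∀ {x m} → Denotes x m → ∃ λ h → ⟦ proj₁ x ⟧ ρ ≡ + h × m ≡ h + h + bit (proj₂ x)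
    half {p , b} eq with ⟦ p ⟧ ρ
    half {p , b}     refl | + h      = h , refl , refl
    half {p , false} ()   | -[1+ h ]
    half {p , true}  ()   | -[1+ h ]

    ⟦value⟧ : ∀ {x m} → Denotes x m → ⟦ value x ⟧ ρ ≡ + m
    ⟦value⟧ {p , b} eq = trans (⟦⊞⟧ (p ⊞ p) (con (+ bit b)) ρ)
      (trans (cong₂ ℤ._+_ (⟦⊞⟧ p p ρ) (⟦con⟧ (+ bit b) ρ)) eq)

    −ʰ-denotes : ∀ {x y m l} → Denotes x m → Denotes y l → l ≤ m → Denotes (x −ʰ y) (m ∸ l)
    −ʰ-denotes {p , b} {q , c} {m} {l} x≡m y≡l l≤m = begin
      D ℤ.+ D ℤ.+ + bit (b xor c)                                ≡⟨ cong (λ z → z ℤ.+ z ℤ.+ + bit (b xor c)) ⟦D⟧ ⟩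
      borrowed b c ℤ.+ borrowed b c ℤ.+ + bit (b xor c)          ≡⟨ borrow b c (⟦ p ⟧ ρ) (⟦ q ⟧ ρ) ⟩
      (⟦ p ⟧ ρ ℤ.+ ⟦ p ⟧ ρ ℤ.+ + bit b) ℤ.- (⟦ q ⟧ ρ ℤ.+ ⟦ q ⟧ ρ ℤ.+ + bit c)
                                                                 ≡⟨ cong₂ ℤ._-_ x≡m y≡l ⟩
      + m ℤ.- + l                                                ≡⟨ ℤ.m-n≡m⊖n m l ⟩
      m ℤ.⊖ l                                                    ≡⟨ ℤ.⊖-≥ l≤m ⟩
      + (m ∸ l)                                                  ∎
      where
      open ≡-Reasoning

      D : ℤ
      D = ⟦ p ⊟ q ⊟ con (+ bit (not b ∧ c)) ⟧ ρ

      borrowed : Bool → Bool → ℤ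
      borrowed b c = ⟦ p ⟧ ρ ℤ.- ⟦ q ⟧ ρ ℤ.- + bit (not b ∧ c)

      ⟦D⟧ : D ≡ borrowed b c
      ⟦D⟧ = trans (⟦⊟⟧ (p ⊟ q) (con (+ bit (not b ∧ c))) ρ)
        (cong₂ ℤ._-_ (⟦⊟⟧ p q ρ) (⟦con⟧ (+ bit (not b ∧ c)) ρ))

      borrow : ∀ b c P Q →
        let d = P ℤ.- Q ℤ.- + bit (not b ∧ c) in
        d ℤ.+ d ℤ.+ + bit (b xor c) ≡ (P ℤ.+ P ℤ.+ + bit b) ℤ.- (Q ℤ.+ Q ℤ.+ + bit c)
      borrow false false = ff
        where
        ff : ∀ P Q → (P ℤ.- Q ℤ.- + 0) ℤ.+ (P ℤ.- Q ℤ.- + 0) ℤ.+ + 0 ≡ (P ℤ.+ P ℤ.+ + 0) ℤ.- (Q ℤ.+ Q ℤ.+ + 0)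
        ff = ℤ-Solver.solve-∀
      borrow false true = ft
        where
        ft : ∀ P Q → (P ℤ.- Q ℤ.- + 1) ℤ.+ (P ℤ.- Q ℤ.- + 1) ℤ.+ + 1 ≡ (P ℤ.+ P ℤ.+ + 0) ℤ.- (Q ℤ.+ Q ℤ.+ + 1)
        ft = ℤ-Solver.solve-∀
      borrow true false = tf
        where
        tf : ∀ P Q → (P ℤ.- Q ℤ.- + 0) ℤ.+ (P ℤ.- Q ℤ.- + 0) ℤ.+ + 1 ≡ (P ℤ.+ P ℤ.+ + 1) ℤ.- (Q ℤ.+ Q ℤ.+ + 0)
        tf = ℤ-Solver.solve-∀
      borrow true true = tt
        where
        tt : ∀ P Q → (P ℤ.- Q ℤ.- + 0) ℤ.+ (P ℤ.- Q ℤ.- + 0) ℤ.+ + 0 ≡ (P ℤ.+ P ℤ.+ + 1) ℤ.- (Q ℤ.+ Q ℤ.+ + 1)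
        tt = ℤ-Solver.solve-∀

    rampʰ-denotes : ∀ p q {x m} → Denotes x m → ⟦ rampʰ p q x ⟧ ρ ≡ + ramp p q m
    rampʰ-denotes p q {r , b} x≡m with h , r≡h , refl ← half x≡m =
      trans (⟦⊞⟧ r (con (+ offset b)) ρ) (trans (cong₂ ℤ._+_ r≡h (⟦con⟧ (+ offset b) ρ)) (cong +_ (sym (climb h b))))
      where
      offset : Bool → ℕ
      offset b = if b then q else p

      climb : ∀ h b → ramp p q (h + h + bit b) ≡ h + offset b
      climb zero    false = refl
      climb zero    true  = refl
      climb (suc h) b     = trans (cong (λ m → ramp p q (suc (m + bit b))) (+-suc h h)) (cong suc (climb h b))

    Minimum : List (Lin n) → ℕ → Set
    Minimum Xs m = Any (λ X → ⟦ X ⟧ ρ ≡ + m) Xs × All (λ X → + m ℤ.≤ ⟦ X ⟧ ρ) Xs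

    minimum-[_] : ∀ {X m} → ⟦ X ⟧ ρ ≡ + m → Minimum (X ∷ []) m
    minimum-[ eq ] = here eq , ℤ.≤-reflexive (sym eq) ∷ []

    minimum-++ : ∀ {Xs Ys a b} → Minimum Xs a → Minimum Ys b → Minimum (Xs ++ Ys) (a ⊓ b)
    minimum-++ {Xs} {Ys} {a} {b} (∃a , a≤) (∃b , b≤) = attained , All.++⁺
      (All.map (ℤ.≤-trans (+≤+ (m⊓n≤m a b))) a≤) (All.map (ℤ.≤-trans (+≤+ (m⊓n≤n a b))) b≤)
      where
      attained : Any (λ X → ⟦ X ⟧ ρ ≡ + (a ⊓ b)) (Xs ++ Ys)
      attained with ⊓-sel a b
      ... | inj₁ eq rewrite eq = Any.++⁺ˡ ∃a
      ... | inj₂ eq rewrite eq = Any.++⁺ʳ Xs ∃b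

    profileʰ-denotes : ∀ t s {x m} → Denotes x m → Minimum (profileʰ t s x) (profile t s m)
    profileʰ-denotes U U x≡m = minimum-[ rampʰ-denotes 0 3 x≡m ]
    profileʰ-denotes U V x≡m = minimum-[ rampʰ-denotes 1 2 x≡m ]
    profileʰ-denotes V U x≡m = minimum-[ rampʰ-denotes 1 2 x≡m ]
    profileʰ-denotes V V {x} x≡m = minimum-++ minimum-[ ⟦value⟧ {x} x≡m ] minimum-[ rampʰ-denotes 2 3 x≡m ]

    minimumClause-holds : ∀ {f side Xs m} → ⟦ f ⟧ ρ ≡ + m → 0ℤ ℤ.≤ ⟦ side ⟧ ρ → Minimum Xs m →
                          Any (ρ ⊨_) (minimumClause f side Xs)
    minimumClause-holds {f} {m = m} f≡m 0≤side (attained , least) = Any.map⁺ (Any.map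
      (λ {X} X≡m → (trans (⟦⊟⟧ f X ρ) (trans (cong₂ ℤ._-_ f≡m X≡m) (ℤ.+-inverseʳ (+ m))) ∷ [])
                 , (0≤side ∷ All.map⁺ (All.map (λ {Y} m≤Y → subst (0ℤ ℤ.≤_) (sym (⟦⊟⟧ Y f ρ))
                     (ℤ.i≤j⇒0≤j-i (subst (ℤ._≤ ⟦ Y ⟧ ρ) (sym f≡m) m≤Y))) least)))
      attained)

    cyclicClause-holds : ∀ {N f ν δ} t s x → Denotes N ν → Denotes x δ → δ ≤ ν →
                         ⟦ f ⟧ ρ ≡ + cyclic ν (profile t s) δ → Any (ρ ⊨_) (cyclicClause N f t s x)
    cyclicClause-holds {N} t s x N≡ν x≡δ δ≤ν f≡ =
      minimumClause-holds f≡ (subst (0ℤ ℤ.≤_) (sym (proj₁ (proj₂ (half {x} x≡δ)))) (+≤+ z≤n))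
        (minimum-++ (profileʰ-denotes t s {x} x≡δ) (profileʰ-denotes t s {N −ʰ x} (−ʰ-denotes {N} {x} N≡ν x≡δ δ≤ν)))

    distClause-holds : ∀ {N f t i s c ν ι κ} → Denotes N ν → Denotes i ι → Denotes c κ → ι ≤ ν → κ ≤ ν →
                       ⟦ f ⟧ ρ ≡ + dist ν (t , ι) (s , κ) → Any (ρ ⊨_) (distClause N f (t , i) (s , c))
    distClause-holds {N} {f} {t} {i} {s} {c} {ν} {ι} {κ} N≡ν i≡ι c≡κ ι≤ν κ≤ν f≡ with ≤-total κ ι
    ... | inj₁ κ≤ι = Any.++⁺ˡ (cyclicClause-holds {N} t s (i −ʰ c) N≡ν (−ʰ-denotes {i} {c} i≡ι c≡κ κ≤ι)
      (≤-trans (m∸n≤m ι κ) ι≤ν) (trans f≡ (cong (λ δ → + cyclic ν (profile t s) δ) (m≤n⇒∣n-m∣≡n∸m κ≤ι))))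
    ... | inj₂ ι≤κ = Any.++⁺ʳ (cyclicClause N f t s (i −ʰ c)) (cyclicClause-holds {N} t s (c −ʰ i) N≡ν (−ʰ-denotes {c} {i} c≡κ i≡ι ι≤κ)
      (≤-trans (m∸n≤m κ ι) κ≤ν) (trans f≡ (cong (λ δ → + cyclic ν (profile t s) δ) (m≤n⇒∣m-n∣≡n∸m ι≤κ))))

    con-denotes : ∀ m b → Denotes (con (+ m) , b) (m + m + bit b)
    con-denotes m b rewrite ⟦con⟧ (+ m) ρ = refl

    ≥-holds : ∀ p q {a b} → ⟦ p ⟧ ρ ≡ + a → ⟦ q ⟧ ρ ≡ + b → b ≤ a → ρ ⊨₊ (p ⊟ q)
    ≥-holds p q p≡a q≡b b≤a = subst (0ℤ ℤ.≤_) (sym (⟦⊟⟧ p q ρ))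
      (ℤ.i≤j⇒0≤j-i (subst (ℤ._≤ ⟦ p ⟧ ρ) (sym q≡b) (subst (+ _ ℤ.≤_) (sym p≡a) (+≤+ b≤a))))

    >-holds : ∀ p q {a b} → ⟦ p ⟧ ρ ≡ + a → ⟦ q ⟧ ρ ≡ + b → b < a → ρ ⊨₊ (p ⊟ (q ⊞ con (+ 1)))
    >-holds p q {b = b} p≡a q≡b b<a = ≥-holds p (q ⊞ con (+ 1)) p≡a
      (trans (⟦⊞⟧ q (con (+ 1)) ρ) (trans (cong₂ ℤ._+_ q≡b (⟦con⟧ (+ 1) ρ)) (cong +_ (+-comm b 1)))) b<a

  -- The graph has 4 k + 2 r₁ + r₀ rungs, and the two vertices, at common
  -- distances f₀, f₁, f₂ from the landmarks, have indices 2 j + e and 2 j′ + e′.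
  f₀ f₁ f₂ J′ K J : Lin 6
  f₀ = var (# 0)
  f₁ = var (# 1)
  f₂ = var (# 2)
  J′ = var (# 3)
  K  = var (# 4)
  J  = var (# 5)

  order : Bool → Bool → Halved 6
  order r₁ r₀ = K ⊞ K ⊞ con (+ bit r₁) , r₀

  -- The index ⌊n/2⌋ − 1 of the third landmark.
  third : Bool → Halved 6
  third false = K ⊟ con (+ 1) , true
  third true  = K , false

  distClauses : Bool → Bool → Kind → Halved 6 → List (Clause 6)
  distClauses r₁ r₀ t i =
    distClause (order r₁ r₀) f₀ (t , i) (U , con (+ 0) , false) ∷
    distClause (order r₁ r₀) f₁ (t , i) (U , con (+ 0) , true) ∷
    distClause (order r₁ r₀) f₂ (t , i) (V , third r₁) ∷ []

  -- Vertices of equal kind and index parity differ only through their halves, in one of two orders.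
  -- In all other cases they differ automatically and no clause arises.
  distinctClauses : Bool → List (Clause 6)
  distinctClauses false = []
  distinctClauses true  = (([] & (J′ ⊟ (J ⊞ con (+ 1)) ∷ [])) ∷ ([] & (J ⊟ (J′ ⊞ con (+ 1)) ∷ [])) ∷ []) ∷ []

  -- `K` ≥ 2 expresses n ≥ 8; a strict inequality between integers becomes a weak one by adding 1.
  bounds : Bool → Bool → Bool → Bool → System 6
  bounds r₁ r₀ e e′ = [] & (K ⊟ con (+ 2) ∷ J ∷ J′
    ∷ value (order r₁ r₀) ⊟ (value (J , e) ⊞ con (+ 1))
    ∷ value (order r₁ r₀) ⊟ (value (J′ , e′) ⊞ con (+ 1)) ∷ [])

  sameClass : Kind → Bool → Kind → Bool → Bool
  sameClass U e U e′ = not (e xor e′)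
  sameClass V e V e′ = not (e xor e′)
  sameClass _ _ _ _  = false

  refuted : Bool → Bool → Kind → Bool → Kind → Bool → Bool
  refuted r₁ r₀ t e t′ e′ = refuteSplit
    (distClauses r₁ r₀ t (J , e) ++ distinctClauses (sameClass t e t′ e′) ++ distClauses r₁ r₀ t′ (J′ , e′))
    (bounds r₁ r₀ e e′)

  ∀ᴮ : (Bool → Bool) → Bool
  ∀ᴮ f = f false ∧ f true

  ∀ᴮ-elim : ∀ f → T (∀ᴮ f) → ∀ b → T (f b)
  ∀ᴮ-elim f h false = proj₁ (Equivalence.to T-∧ h)
  ∀ᴮ-elim f h true  = proj₂ (Equivalence.to (T-∧ {f false}) h)

  ∀ᴷ : (Kind → Bool) → Bool
  ∀ᴷ f = f U ∧ f V

  ∀ᴷ-elim : ∀ f → T (∀ᴷ f) → ∀ t → T (f t)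
  ∀ᴷ-elim f h U = proj₁ (Equivalence.to T-∧ h)
  ∀ᴷ-elim f h V = proj₂ (Equivalence.to (T-∧ {f U}) h)

  -- The 64 combinations of parities and kinds form a single closed Boolean. It evaluates to `true`,
  -- so that `_` is solved.
  all-refuted : ∀ r₁ r₀ t e t′ e′ → T (refuted r₁ r₀ t e t′ e′)
  all-refuted r₁ r₀ t e t′ e′ =
    ∀ᴮ-elim (λ e′ → refuted r₁ r₀ t e t′ e′) (
    ∀ᴷ-elim (λ t′ → ∀ᴮ λ e′ → refuted r₁ r₀ t e t′ e′) (
    ∀ᴮ-elim (λ e → ∀ᴷ λ t′ → ∀ᴮ λ e′ → refuted r₁ r₀ t e t′ e′) (
    ∀ᴷ-elim (λ t → ∀ᴮ λ e → ∀ᴷ λ t′ → ∀ᴮ λ e′ → refuted r₁ r₀ t e t′ e′) (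
    ∀ᴮ-elim (λ r₀ → ∀ᴷ λ t → ∀ᴮ λ e → ∀ᴷ λ t′ → ∀ᴮ λ e′ → refuted r₁ r₀ t e t′ e′) (
    ∀ᴮ-elim (λ r₁ → ∀ᴮ λ r₀ → ∀ᴷ λ t → ∀ᴮ λ e → ∀ᴷ λ t′ → ∀ᴮ λ e′ → refuted r₁ r₀ t e t′ e′)
    _ r₁) r₀) t) e) t′) e′

  -- Both lines have the shape h + h + bit that `lift` produces, which accounts for the `+ 0`.
  landmark : Bool → ℕ → ℕ
  landmark false k = pred k + pred k + 1
  landmark true  k = k + k + 0

  -- Refutation starts from `x ≢ y`, hence the double negation; `located` removes it because
  -- equality is decidable.
  triple-injective : ∀ r₁ r₀ k′ → let ν = (k′ + k′ + bit r₁) + (k′ + k′ + bit r₁) + bit r₀ in 2 ≤ k′ →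
    landmark r₁ k′ < ν → ∀ {x y} → proj₂ x < ν → proj₂ y < ν →
    dist ν x (U , 0) ≡ dist ν y (U , 0) → dist ν x (U , 1) ≡ dist ν y (U , 1) →
    dist ν x (V , landmark r₁ k′) ≡ dist ν y (V , landmark r₁ k′) → ¬ x ≢ y
  triple-injective r₁ r₀ κ 2≤κ l<ν {t , m} {t′ , m′} x<ν y<ν eq₀ eq₁ eq₂ x≢y
    with parity-split m | parity-split m′
  ... | a , e , refl | b , e′ , refl = refuteSplit-sound
    (distClauses r₁ r₀ t (J , e) ++ distinctClauses (sameClass t e t′ e′) ++ distClauses r₁ r₀ t′ (J′ , e′))
    (bounds r₁ r₀ e e′) (all-refuted r₁ r₀ t e t′ e′) ρ
    (All.++⁺ (distances t (J , e) {a + a + bit e} j≡ (<⇒≤ x<ν) refl refl refl)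
      (All.++⁺ (distinct t e t′ e′ x≢y)
        (distances t′ (J′ , e′) {b + b + bit e′} j′≡ (<⇒≤ y<ν) eq₀ eq₁ eq₂)))
    ([] , ≥-holds ρ K (con (+ 2)) (⟦var⟧ (# 4) ρ) (⟦con⟧ (+ 2) ρ) 2≤κ
        ∷ subst (0ℤ ℤ.≤_) (sym (⟦var⟧ (# 5) ρ)) (+≤+ z≤n) ∷ subst (0ℤ ℤ.≤_) (sym (⟦var⟧ (# 3) ρ)) (+≤+ z≤n)
        ∷ >-holds ρ (value (order r₁ r₀)) (value (J , e)) (⟦value⟧ ρ {order r₁ r₀} order≡) (⟦value⟧ ρ {J , e} j≡) x<ν
        ∷ >-holds ρ (value (order r₁ r₀)) (value (J′ , e′)) (⟦value⟧ ρ {order r₁ r₀} order≡) (⟦value⟧ ρ {J′ , e′} j′≡) y<ν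
        ∷ [])
    where
    ν : ℕ
    ν = (κ + κ + bit r₁) + (κ + κ + bit r₁) + bit r₀

    d₀ d₁ d₂ : ℕ
    d₀ = dist ν (t , a + a + bit e) (U , 0)
    d₁ = dist ν (t , a + a + bit e) (U , 1)
    d₂ = dist ν (t , a + a + bit e) (V , landmark r₁ κ)

    ρ : Vec ℤ 6
    -- The distances of the first vertex give `f₀`, `f₁` and `f₂`; by the assumed equalities they
    -- are those of the second as well.
    ρ = + d₀ ∷ + d₁ ∷ + d₂ ∷ + b ∷ + κ ∷ + a ∷ []

    lift : ∀ {p e h} → ⟦ p ⟧ ρ ≡ + h → Denotes ρ (p , e) (h + h + bit e)
    lift {e = e} p≡h = cong (λ z → z ℤ.+ z ℤ.+ + bit e) p≡h

    j≡ : Denotes ρ (J , e) (a + a + bit e)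
    j≡ = lift {J} {e} (⟦var⟧ (# 5) ρ)

    j′≡ : Denotes ρ (J′ , e′) (b + b + bit e′)
    j′≡ = lift {J′} {e′} (⟦var⟧ (# 3) ρ)

    order≡ : Denotes ρ (order r₁ r₀) ν
    order≡ = lift {K ⊞ K ⊞ con (+ bit r₁)} {r₀} (⟦value⟧ ρ {K , r₁} (lift {K} {r₁} (⟦var⟧ (# 4) ρ)))

    third≡ : ∀ r₁ → Denotes ρ (third r₁) (landmark r₁ κ)
    third≡ true  = lift {K} {false} (⟦var⟧ (# 4) ρ)
    third≡ false = lift {K ⊟ con (+ 1)} {true} (trans (⟦⊟⟧ K (con (+ 1)) ρ)
      (trans (cong₂ ℤ._-_ (⟦var⟧ (# 4) ρ) (⟦con⟧ (+ 1) ρ)) (predecessor 2≤κ)))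
      where
      predecessor : ∀ {κ} → 2 ≤ κ → + κ ℤ.- + 1 ≡ + pred κ
      predecessor (s≤s _) = refl

    1≤ν : 1 ≤ ν
    1≤ν = ≤-trans (s≤s z≤n) x<ν

    distances : ∀ t i {ι} → Denotes ρ i ι → ι ≤ ν → d₀ ≡ dist ν (t , ι) (U , 0) → d₁ ≡ dist ν (t , ι) (U , 1) →
                d₂ ≡ dist ν (t , ι) (V , landmark r₁ κ) → All (Any (ρ ⊨_)) (distClauses r₁ r₀ t i)
    distances t i i≡ι ι≤ν e₀ e₁ e₂ =
      distClause-holds ρ {order r₁ r₀} {f₀} {t} {i} {U} {con (+ 0) , false} order≡ i≡ι (con-denotes ρ 0 false) ι≤ν z≤n
        (trans (⟦var⟧ (# 0) ρ) (cong +_ e₀)) ∷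
      distClause-holds ρ {order r₁ r₀} {f₁} {t} {i} {U} {con (+ 0) , true} order≡ i≡ι (con-denotes ρ 0 true) ι≤ν 1≤ν
        (trans (⟦var⟧ (# 1) ρ) (cong +_ e₁)) ∷
      distClause-holds ρ {order r₁ r₀} {f₂} {t} {i} {V} {third r₁} order≡ i≡ι (third≡ r₁) ι≤ν (<⇒≤ l<ν)
        (trans (⟦var⟧ (# 2) ρ) (cong +_ e₂)) ∷ []

    ordered : a ≢ b → All (Any (ρ ⊨_)) (distinctClauses true)
    ordered a≢b with <-cmp a b
    ... | tri< a<b _ _ = here ([] , >-holds ρ J′ J (⟦var⟧ (# 3) ρ) (⟦var⟧ (# 5) ρ) a<b ∷ []) ∷ []
    ... | tri≈ _ a≡b _ = ⊥-elim (a≢b a≡b)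
    ... | tri> _ _ b<a = there (here ([] , >-holds ρ J J′ (⟦var⟧ (# 5) ρ) (⟦var⟧ (# 3) ρ) b<a ∷ [])) ∷ []

    distinct : ∀ t e t′ e′ → (t , a + a + bit e) ≢ (t′ , b + b + bit e′) → All (Any (ρ ⊨_)) (distinctClauses (sameClass t e t′ e′))
    distinct U false U false ne = ordered λ { refl → ne refl }
    distinct U true  U true  ne = ordered λ { refl → ne refl }
    distinct V false V false ne = ordered λ { refl → ne refl }
    distinct V true  V true  ne = ordered λ { refl → ne refl }
    distinct U false U true  ne = []
    distinct U true  U false ne = []
    distinct V false V true  ne = []
    distinct V true  V false ne = []
    distinct U _     V _     ne = []
    distinct V _     U _     ne = []

open TripleInjectivity using (bit; parity-split; landmark; triple-injective)

-- Upper bound: locating triples for every n ≥ 5.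

Locates : (n : ℕ) → Fin (n + n) → Fin (n + n) → Fin (n + n) → Set
Locates n a b c = ∀ x y → distance {n} x a ≡ distance {n} y a → distance {n} x b ≡ distance {n} y b →
                  distance {n} x c ≡ distance {n} y c → x ≡ y

locates? : ∀ n a b c → Dec (Locates n a b c)
locates? n a b c = Fin.all? λ x → Fin.all? λ y →
  (distance {n} x a ℕ.≟ distance {n} y a) →-dec (distance {n} x b ℕ.≟ distance {n} y b) →-dec
  (distance {n} x c ℕ.≟ distance {n} y c) →-dec (x Fin.≟ y)

coordinates-injective : ∀ {x y : Fin (n + n)} → 2 < n → coordinates {n} x ≡ coordinates {n} y → x ≡ y
coordinates-injective {n} {x} {y} 2<n eq =
  trans (sym (vertex-coordinates 2<n x)) (trans (cong (toVertex 2<n) eq) (vertex-coordinates 2<n y))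

coordinates-vertex : (2<n : 2 < n) → ∀ t {i} → i < n → coordinates {n} (vertex 2<n t i) ≡ (t , i)
coordinates-vertex {n} 2<n t {i} i<n = trans (cong label (Fin.splitAt-join n n (side t j)))
  (trans (label-side t j) (cong (t ,_) (trans (Fin.toℕ-fromℕ< _) (m<n⇒m%n≡m i<n))))
  where
  instance
    n≢0 : NonZero n
    n≢0 = >-nonZero (≤-trans z<s 2<n)

  j : Fin n
  j = i mod n

  label-side : ∀ t (j : Fin n) → label (side t j) ≡ (t , toℕ j)
  label-side U j = refl
  label-side V j = refl

landmark< : ∀ r₁ r₀ k → 2 ≤ k → landmark r₁ k < (k + k + bit r₁) + (k + k + bit r₁) + bit r₀
landmark< r₁ r₀ k 2≤k = begin-strict
  landmark r₁ k                                   ≤⟨ landmark≤ r₁ k (≤-trans (s≤s z≤n) 2≤k) ⟩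
  k + k                                           <⟨ m<m+n (k + k) (≤-trans (≤-trans (s≤s z≤n) 2≤k) (m≤m+n k k)) ⟩
  (k + k) + (k + k)                               ≤⟨ +-mono-≤ (m≤m+n (k + k) (bit r₁)) (m≤m+n (k + k) (bit r₁)) ⟩
  (k + k + bit r₁) + (k + k + bit r₁)             ≤⟨ m≤m+n _ (bit r₀) ⟩
  (k + k + bit r₁) + (k + k + bit r₁) + bit r₀    ∎
  where
  open ≤-Reasoning

  landmark≤ : ∀ r₁ k → 1 ≤ k → landmark r₁ k ≤ k + k
  landmark≤ true  k       _ = ≤-reflexive (+-identityʳ (k + k))
  landmark≤ false (suc k) _ = ≤-trans (≤-reflexive (+-comm (k + k) 1)) (s≤s (+-monoʳ-≤ k (n≤1+n k)))

quarter≥2 : ∀ r₁ r₀ k → 8 ≤ (k + k + bit r₁) + (k + k + bit r₁) + bit r₀ → 2 ≤ k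
quarter≥2 r₁    r₀    (suc (suc k)) 8≤ = s≤s (s≤s z≤n)
quarter≥2 false false 0 ()
quarter≥2 false true  0 (s≤s ())
quarter≥2 true  false 0 (s≤s (s≤s ()))
quarter≥2 true  true  0 (s≤s (s≤s (s≤s ())))
quarter≥2 false false 1 (s≤s (s≤s (s≤s (s≤s ()))))
quarter≥2 false true  1 (s≤s (s≤s (s≤s (s≤s (s≤s ())))))
quarter≥2 true  false 1 (s≤s (s≤s (s≤s (s≤s (s≤s (s≤s ()))))))
quarter≥2 true  true  1 (s≤s (s≤s (s≤s (s≤s (s≤s (s≤s (s≤s ())))))))

locating-triple-≥8 : 8 ≤ n → 2 < n → ∃[ a ] ∃[ b ] ∃[ c ] Locates n a b c
-- Halving `n` and then its half writes it as 4k + 2r₁ + r₀.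
locating-triple-≥8 {n} 8≤n 2<n with parity-split n
... | h , r₀ , refl with parity-split h
... | k , r₁ , refl = vertex 2<n U 0 , vertex 2<n U 1 , vertex 2<n V (landmark r₁ k) , located
  where
  2≤k : 2 ≤ k
  2≤k = quarter≥2 r₁ r₀ k 8≤n

  l<n : landmark r₁ k < n
  l<n = landmark< r₁ r₀ k 2≤k

  to-dist : ∀ {t i x y} → i < n → distance {n} x (vertex 2<n t i) ≡ distance {n} y (vertex 2<n t i) →
            dist n (coordinates {n} x) (t , i) ≡ dist n (coordinates {n} y) (t , i)
  to-dist {t} {i} {x} {y} i<n =
    subst (λ w → dist n (coordinates {n} x) w ≡ dist n (coordinates {n} y) w) (coordinates-vertex 2<n t i<n)

  located : Locates n (vertex 2<n U 0) (vertex 2<n U 1) (vertex 2<n V (landmark r₁ k))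
  located x y e₀ e₁ e₂ = coordinates-injective {n} 2<n (decidable-stable (≡-dec _≟ᴷ_ ℕ._≟_ _ _)
    (triple-injective r₁ r₀ k 2≤k l<n (label< (splitAt n x)) (label< (splitAt n y))
      (to-dist {x = x} {y} (≤-trans z<s 2<n) e₀) (to-dist {x = x} {y} (≤-trans (s≤s z<s) 2<n) e₁) (to-dist {x = x} {y} l<n e₂)))

locating-triple : 5 ≤ n → 2 < n → ∃[ a ] ∃[ b ] ∃[ c ] Locates n a b c
-- Counting indices from 0, the triples for n = 5, 6, 7 are u₀, u₁, v₂, then u₀, u₁, u₂, then u₀,
-- u₁, v₀; each is verified on all pairs of vertices.
locating-triple {5} _ _ = # 0 , # 1 , # 7 , from-yes (locates? 5 (# 0) (# 1) (# 7))
locating-triple {6} _ _ = # 0 , # 1 , # 2 , from-yes (locates? 6 (# 0) (# 1) (# 2))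
locating-triple {7} _ _ = # 0 , # 1 , # 7 , from-yes (locates? 7 (# 0) (# 1) (# 7))
locating-triple {suc (suc (suc (suc (suc (suc (suc (suc m)))))))} _ 2<n = locating-triple-≥8 (m≤m+n 8 m) 2<n
locating-triple {1} (s≤s ()) _
locating-triple {2} (s≤s (s≤s ())) _
locating-triple {3} (s≤s (s≤s (s≤s ()))) _
locating-triple {4} (s≤s (s≤s (s≤s (s≤s ())))) _

-- Metric dimension and threshold dimension of P(n,2).

∣p∪q∣≤∣p∣+∣q∣ : (p q : Subset N) → ∣ p ∪ q ∣ ≤ ∣ p ∣ + ∣ q ∣
∣p∪q∣≤∣p∣+∣q∣ []            []            = z≤n
∣p∪q∣≤∣p∣+∣q∣ (outside ∷ p) (outside ∷ q) = ∣p∪q∣≤∣p∣+∣q∣ p q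
∣p∪q∣≤∣p∣+∣q∣ (outside ∷ p) (inside  ∷ q) =
  ≤-trans (s≤s (∣p∪q∣≤∣p∣+∣q∣ p q)) (≤-reflexive (sym (+-suc ∣ p ∣ ∣ q ∣)))
∣p∪q∣≤∣p∣+∣q∣ (inside  ∷ p) (outside ∷ q) = s≤s (∣p∪q∣≤∣p∣+∣q∣ p q)
∣p∪q∣≤∣p∣+∣q∣ (inside  ∷ p) (inside  ∷ q) =
  s≤s (≤-trans (∣p∪q∣≤∣p∣+∣q∣ p q) (+-monoʳ-≤ ∣ p ∣ (n≤1+n ∣ q ∣)))

triple : (a b c : Fin N) → Subset N
triple a b c = ⁅ a ⁆ ∪ (⁅ b ⁆ ∪ ⁅ c ⁆)

-- Only an upper bound, so the landmarks need no proof of being distinct; the lower bound turns it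
-- into an equality.
∣triple∣≤3 : (a b c : Fin N) → ∣ triple a b c ∣ ≤ 3
∣triple∣≤3 a b c = ≤-trans (∣p∪q∣≤∣p∣+∣q∣ ⁅ a ⁆ (⁅ b ⁆ ∪ ⁅ c ⁆)) (+-mono-≤ (≤-reflexive (∣⁅x⁆∣≡1 a))
  (≤-trans (∣p∪q∣≤∣p∣+∣q∣ ⁅ b ⁆ ⁅ c ⁆) (≤-reflexive (cong₂ _+_ (∣⁅x⁆∣≡1 b) (∣⁅x⁆∣≡1 c)))))

triple-resolves : (2<n : 2 < n) → ∀ {a b c} → Locates n a b c → IsResolvingSet (P n 2 2<n) (triple a b c)
triple-resolves {n} 2<n {a} {b} {c} located x y x≢y
  with distance {n} x a ℕ.≟ distance {n} y a | distance {n} x b ℕ.≟ distance {n} y b | distance {n} x c ℕ.≟ distance {n} y c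
... | no ≢a | _     | _     = a , p⊆p∪q _ (x∈⁅x⁆ a) , distance-resolves 2<n ≢a
... | yes _ | no ≢b | _     = b , q⊆p∪q ⁅ a ⁆ _ (p⊆p∪q _ (x∈⁅x⁆ b)) , distance-resolves 2<n ≢b
... | yes _ | yes _ | no ≢c = c , q⊆p∪q ⁅ a ⁆ _ (q⊆p∪q ⁅ b ⁆ _ (x∈⁅x⁆ c)) , distance-resolves 2<n ≢c
... | yes ≡a | yes ≡b | yes ≡c = ⊥-elim (x≢y (located x y ≡a ≡b ≡c))

theorem4p3 : (n : ℕ) (n≥5 : 5 ≤ n) → Irreducible (P n 2 (m+n≤o⇒n≤o 2 n≥5))
theorem4p3 n n≥5 = 3
  -- P(n,2) is its own spanning supergraph and attains 3, while `resolving-set-≥3` holds for every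
  -- `H`.
  , ((G₂ , id , dimension) , λ { j (H , G⊆H , (W , resolving , refl) , _) → resolving-set-≥3 2<n G⊆H n≥5 W resolving })
  , dimension
  where
  2<n : 2 < n
  2<n = m+n≤o⇒n≤o 2 n≥5

  G₂ : Graph (n + n)
  G₂ = P n 2 2<n

  dimension : IsMetricDimension G₂ 3
  dimension with locating-triple n≥5 2<n
  ... | a , b , c , located =
    (triple a b c , resolves , ≤-antisym (∣triple∣≤3 a b c) (resolving-set-≥3 2<n {G₂} id n≥5 _ resolves))
    , λ { j (W , resolving , refl) → resolving-set-≥3 2<n {G₂} id n≥5 W resolving }
    where
    resolves : IsResolvingSet G₂ (triple a b c)
    resolves = triple-resolves 2<n located
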